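{- Let $p=4$ or $p=6$, and let $D$ be a $p$-angulation of a polygon with $n+3$ vertices. Let $T_D^{\bullet}$ be the associated triangulation. Let $v_0,\dots,v_{n+2}$ be the vertices of the Farey path of $D$, and let $w_0,\dots,w_{n+2}$ be the vertices of the Farey path $P_T'$ of the triangulation $T_D^{\bullet}$. Then $$w_\alpha=\frac{1}{\lambda_p}v_\alpha$$ for $0\le\alpha\le n+2$.
   Context: A $p$-angulation $D$ of a convex regular polygon $P$ is a set of non-intersecting diagonals partitioning $P$ into a finite collection of $p$-gons (a triangulation is the case $p=3$). Put $\lambda_p=2\cos(\pi/p)$, so $\lambda_3=1$, $\lambda_4=\sqrt2$, $\lambda_6=\sqrt3$. Let $P$ have $n+3$ vertices, labelled $0,1,\dots,n+2$ in cyclic order (for $p\in\{4,6\}$ the existence of a $p$-angulation forces $n+3$ to be even). Every edge of the $p$-angulation $D$ then joins an even vertex to an odd vertex, so each $p$-gon of $D$ has $p/2$ odd vertices. The associated triangulation $T_D^{\bullet}$ of $P$ consists of the diagonals of $D$ together with, for every $p$-gon of $D$, all diagonals joining two odd vertices of that $p$-gon (one diagonal per $4$-gon if $p=4$, three diagonals per $6$-gon if $p=6$). For a $p'$-angulation $E$ of $P$ (any $p'\ge3$), let $q_\alpha$ be the number of $p'$-gons of $E$ incident with the vertex $\alpha$. The vertices $u_0,\dots,u_{n+2}$ of the Farey path of $E$ are the elements of $\mathbb{R}\cup\{\infty\}$ given by $u_0=\infty$ and $u_\alpha=\xi_0\xi_1\cdots\xi_{\alpha-1}(\infty)$ (composition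 of maps) for $1\le\alpha\le n+2$, where $\xi_\alpha$ is the Möbius transformation $\xi_\alpha(z)=q_\alpha\lambda_{p'}-\frac1z$. Thus the $v_\alpha$ are obtained with $E=D$, $p'=p$, and the $w_\alpha$ with $E=T_D^{\bullet}$, $p'=3$. The convention $\frac{1}{\lambda_p}\infty=\infty$ is used. -}

module Defs where

open import Level as Level using (Level; 0ℓ; _⊔_)
open import Algebra.Bundles using (CommutativeRing)
open import Algebra.Core using (Op₁; Op₂)
open import Algebra.Structures using (IsCommutativeRing)
open import Data.Fin.Base using (Fin; zero; suc; toℕ; _<_; _≤_)
open import Data.Fin.Properties using (all?; _≟_; _<?_; _≤?_)
open import Data.Fin.Subset using (Subset; inside; outside; _∈_; ∣_∣)
open import Data.Fin.Subset.Properties using (_∈?_; anySubset?)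
open import Data.List.Base using (List; []; _∷_; _++_; map; filter; length)
open import Data.Nat.Base as ℕ using (ℕ)
open import Data.Nat.Divisibility using (_∣_; _∤_; _∣?_; _∣0; ∣m∣n⇒∣m+n; divides)
import Data.Nat.Properties as ℕ
open import Data.Product.Base using (_×_; _,_; ∃; proj₁; proj₂)
open import Data.Sum.Base using (_⊎_; inj₁; inj₂; [_,_]′)
import Data.Vec.Base as Vec
open import Function.Base using (_∘_; id)
open import Function.Bundles using (_⇔_; mk⇔; Equivalence)
open import Relation.Binary.Core using (Rel)
import Relation.Binary.Construct.Add.Point.Equality as PointEquality
open import Relation.Binary.Definitions using (Decidable; Symmetric; tri<; tri≈; tri>)
open import Relation.Binary.PropositionalEquality.Core using (_≡_; _≢_; refl; sym; subst)
open import Relation.Binary.Structures using (IsStrictTotalOrder)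
open import Relation.Nullary.Construct.Add.Point using (Pointed; ∙; [_])
open import Relation.Nullary.Decidable.Core
  using (Dec; yes; no; map′; _×-dec_; _⊎-dec_; _→-dec_; ¬?)
open import Relation.Nullary.Negation.Core using (¬_)

------------------------------------------------------------------------
-- Dissections of a convex polygon with vertices 0, …, N-1

module _ {N : ℕ} where

  Next : Rel (Fin N) 0ℓ
  Next i j = ℕ.suc (toℕ i) ≡ toℕ j ⊎ (ℕ.suc (toℕ i) ≡ N × toℕ j ≡ 0)

  Side : Rel (Fin N) 0ℓ
  Side i j = Next i j ⊎ Next j i

  Next? : Decidable Next
  Next? i j = (ℕ.suc (toℕ i) ℕ.≟ toℕ j) ⊎-dec
              ((ℕ.suc (toℕ i) ℕ.≟ N) ×-dec (toℕ j ℕ.≟ 0))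

  Side? : Decidable Side
  Side? i j = Next? i j ⊎-dec Next? j i

record Diagonals (N : ℕ) : Set₁ where
  infix 4 _∼_ _∼?_
  field
    _∼_     : Rel (Fin N) 0ℓ
    _∼?_    : Decidable _∼_
    ∼-sym   : Symmetric _∼_
    ∼⇒≢     : ∀ {i j} → i ∼ j → i ≢ j
    ∼⇒¬Side : ∀ {i j} → i ∼ j → ¬ Side i j

  Edge : Rel (Fin N) 0ℓ
  Edge i j = i ∼ j ⊎ Side i j

  Edge? : Decidable Edge
  Edge? i j = (i ∼? j) ⊎-dec Side? i j

-- By symmetry of _∼_, it suffices to list the endpoints of two crossing
-- diagonals in increasing order.
NonCrossing : ∀ {N} → Diagonals N → Set
NonCrossing E = ∀ {i j k l} → i < j → j < k → k < l → i ∼ k → ¬ (j ∼ l)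
  where open Diagonals E

-- For i < j in S: i and j are cyclically consecutive among the elements of
-- S, the second alternative being that i is the least and j the greatest.
Consecutive : ∀ {N} → Subset N → Rel (Fin N) 0ℓ
Consecutive S i j = (∀ k → k ∈ S → ¬ (i < k × k < j))
                  ⊎ (∀ k → k ∈ S → i ≤ k × k ≤ j)

-- The polygons into which a set of non-crossing diagonals cuts P, given by
-- their vertex sets: S is such a polygon when the sides of its convex hull
-- are edges and no edge joins two non-consecutive vertices of S.
IsCell : ∀ {N} → Diagonals N → Subset N → Set
IsCell E S = 3 ℕ.≤ ∣ S ∣
           × (∀ i j → i ∈ S → j ∈ S → i < j → Consecutive S i j ⇔ Edge i j)
  where open Diagonals E

IsGonOf : ∀ {N} → ℕ → Diagonals N → Subset N → Set
IsGonOf p E S = IsCell E S × ∣ S ∣ ≡ p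

IsAngulation : ∀ {N} → ℕ → Diagonals N → Set
IsAngulation p E = NonCrossing E × (∀ S → IsCell E S → ∣ S ∣ ≡ p)

Consecutive? : ∀ {N} (S : Subset N) → Decidable (Consecutive S)
Consecutive? S i j =
  all? (λ k → (k ∈? S) →-dec ¬? ((i <? k) ×-dec (k <? j)))
  ⊎-dec all? (λ k → (k ∈? S) →-dec ((i ≤? k) ×-dec (k ≤? j)))

infixr 2 _⇔-dec_
_⇔-dec_ : ∀ {A B : Set} → Dec A → Dec B → Dec (A ⇔ B)
a? ⇔-dec b? = map′ (λ (f , g) → mk⇔ f g)
                   (λ e → Equivalence.to e , Equivalence.from e)
                   ((a? →-dec b?) ×-dec (b? →-dec a?))

IsGonOf? : ∀ {N} p (E : Diagonals N) (S : Subset N) → Dec (IsGonOf p E S)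
IsGonOf? p E S =
  ((3 ℕ.≤? ∣ S ∣)
   ×-dec all? (λ i → all? (λ j → (i ∈? S) →-dec ((j ∈? S) →-dec ((i <? j) →-dec
           (Consecutive? S i j ⇔-dec Edge? i j))))))
  ×-dec (∣ S ∣ ℕ.≟ p)
  where open Diagonals E

subsets : ∀ N → List (Subset N)
subsets ℕ.zero    = Vec.[] ∷ []
subsets (ℕ.suc N) = map (outside Vec.∷_) (subsets N)
                 ++ map (inside  Vec.∷_) (subsets N)

-- The number of p-gons of E incident with α.
gonsAt : ∀ {N} → ℕ → Diagonals N → Fin N → ℕ
gonsAt {N} p E α =
  length (filter (λ S → IsGonOf? p E S ×-dec (α ∈? S)) (subsets N))

------------------------------------------------------------------------
-- The triangulation associated with a p-angulation

Odd : ∀ {N} → Fin N → Set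
Odd i = 2 ∤ toℕ i

Odd? : ∀ {N} (i : Fin N) → Dec (Odd i)
Odd? i = ¬? (2 ∣? toℕ i)

2∣n⊎2∣1+n : ∀ n → (2 ∣ n) ⊎ (2 ∣ ℕ.suc n)
2∣n⊎2∣1+n ℕ.zero    = inj₁ (2 ∣0)
2∣n⊎2∣1+n (ℕ.suc n) with 2∣n⊎2∣1+n n
... | inj₁ 2∣n  = inj₂ (∣m∣n⇒∣m+n (divides 1 refl) 2∣n)
... | inj₂ 2∣1+n = inj₁ 2∣1+n

odd⇒¬Next : ∀ {N} {i j : Fin N} → Odd i → Odd j → ¬ Next i j
odd⇒¬Next {i = i} oi oj (inj₁ 1+i≡j) =
  [ oi , oj ∘ subst (2 ∣_) 1+i≡j ]′ (2∣n⊎2∣1+n (toℕ i))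
odd⇒¬Next oi oj (inj₂ (_ , j≡0)) = oj (subst (2 ∣_) (sym j≡0) (2 ∣0))

-- i and j are distinct odd vertices of a common p-gon of D.
OddPair : ∀ {N} → ℕ → Diagonals N → Rel (Fin N) 0ℓ
OddPair p D i j = (i ≢ j × Odd i × Odd j)
                × ∃ λ S → IsGonOf p D S × i ∈ S × j ∈ S

associated : ∀ {N} → ℕ → Diagonals N → Diagonals N
associated p D = record
  { _∼_     = λ i j → i ∼ j ⊎ OddPair p D i j
  ; _∼?_    = λ i j → (i ∼? j) ⊎-dec
      ((¬? (i ≟ j) ×-dec (Odd? i ×-dec Odd? j)) ×-dec
       anySubset? (λ S → IsGonOf? p D S ×-dec ((i ∈? S) ×-dec (j ∈? S))))
  ; ∼-sym   = λ
      { (inj₁ i∼j) → inj₁ (∼-sym i∼j)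
      ; (inj₂ ((i≢j , oi , oj) , S , S-gon , i∈S , j∈S)) →
          inj₂ ((i≢j ∘ sym , oj , oi) , S , S-gon , j∈S , i∈S) }
  ; ∼⇒≢     = λ
      { (inj₁ i∼j) → ∼⇒≢ i∼j
      ; (inj₂ ((i≢j , _) , _)) → i≢j }
  ; ∼⇒¬Side = λ
      { (inj₁ i∼j) → ∼⇒¬Side i∼j
      ; (inj₂ ((_ , oi , oj) , _)) → [ odd⇒¬Next oi oj , odd⇒¬Next oj oi ]′ }
  }
  where open Diagonals D

------------------------------------------------------------------------
-- Ordered fields (linearly ordered, so with decidable equality): classical
-- ℝ is one, and so is any subfield of it such as ℚ(√2) or ℚ(√3)

record OrderedField c ℓ₁ ℓ₂ : Set (Level.suc (c ⊔ ℓ₁ ⊔ ℓ₂)) where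
  infix  8 -_
  infixl 7 _*_
  infixl 6 _+_
  infix  4 _≈_ _<ᶠ_
  field
    Carrier            : Set c
    _≈_                : Rel Carrier ℓ₁
    _<ᶠ_               : Rel Carrier ℓ₂
    _+_                : Op₂ Carrier
    _*_                : Op₂ Carrier
    -_                 : Op₁ Carrier
    0#                 : Carrier
    1#                 : Carrier
    isCommutativeRing  : IsCommutativeRing _≈_ _+_ _*_ -_ 0# 1#
    isStrictTotalOrder : IsStrictTotalOrder _≈_ _<ᶠ_
    0≉1                : ¬ (0# ≈ 1#)
    inverse            : ∀ x → ¬ (x ≈ 0#) → ∃ λ y → x * y ≈ 1#
    +-monoʳ-<          : ∀ x {y z} → y <ᶠ z → (x + y) <ᶠ (x + z)
    *-positive         : ∀ {x y} → 0# <ᶠ x → 0# <ᶠ y → 0# <ᶠ (x * y)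

  commutativeRing : CommutativeRing c ℓ₁
  commutativeRing = record { isCommutativeRing = isCommutativeRing }

  open CommutativeRing commutativeRing public
    using (_-_; semiring; setoid) renaming (refl to ≈-refl; sym to ≈-sym; trans to ≈-trans)

  open IsStrictTotalOrder isStrictTotalOrder public
    using () renaming (compare to <ᶠ-compare; _≟_ to _≈?_)

  _⁻¹⟨_⟩ : ∀ x → ¬ (x ≈ 0#) → Carrier
  x ⁻¹⟨ x≉0 ⟩ = proj₁ (inverse x x≉0)

  positive⇒≉0 : ∀ {x} → 0# <ᶠ x → ¬ (x ≈ 0#)
  positive⇒≉0 {x} 0<x x≈0 with <ᶠ-compare 0# x
  ... | tri< _ 0≉x _ = 0≉x (≈-sym x≈0)
  ... | tri≈ 0≮x _ _ = 0≮x 0<x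
  ... | tri> 0≮x _ _ = 0≮x 0<x

------------------------------------------------------------------------
-- Farey paths

-- compose ξ α = ξ 0 ∘ ξ 1 ∘ ⋯ ∘ ξ (α - 1)
compose : ∀ {a} {A : Set a} {N} → (Fin N → A → A) → Fin N → A → A
compose ξ zero    = id
compose ξ (suc α) = ξ zero ∘ compose (ξ ∘ suc) α

module Farey {c ℓ₁ ℓ₂ : Level} (K : OrderedField c ℓ₁ ℓ₂) where

  open OrderedField K
  open import Algebra.Properties.Semiring.Mult semiring
    using () renaming (_×_ to _·_)

  K∞ : Set c
  K∞ = Pointed Carrier

  pattern ∞ = ∙

  open PointEquality _≈_ public using () renaming (_≈∙_ to _≈∞_)

  -- Lambda p x says that x = λ_p = 2 cos (π / p), for the three values of p
  -- in play: λ₃ = 1, λ₄ = √2, λ₆ = √3.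
  data Lambda : ℕ → Carrier → Set (c ⊔ ℓ₁ ⊔ ℓ₂) where
    λ₃ : ∀ {x} → x ≈ 1#                            → Lambda 3 x
    λ₄ : ∀ {x} → 0# <ᶠ x → x * x ≈ 1# + 1#         → Lambda 4 x
    λ₆ : ∀ {x} → 0# <ᶠ x → x * x ≈ (1# + 1#) + 1#  → Lambda 6 x

  1-isλ₃ : Lambda 3 1#
  1-isλ₃ = λ₃ ≈-refl

  Lambda⇒≉0 : ∀ {p x} → Lambda p x → ¬ (x ≈ 0#)
  Lambda⇒≉0 (λ₃ x≈1)   x≈0 = 0≉1 (≈-trans (≈-sym x≈0) x≈1)
  Lambda⇒≉0 (λ₄ 0<x _) = positive⇒≉0 0<x
  Lambda⇒≉0 (λ₆ 0<x _) = positive⇒≉0 0<x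

  -- z ↦ t - 1/z
  möbius : Carrier → K∞ → K∞
  möbius t ∞ = [ t ]
  möbius t [ z ] with z ≈? 0#
  ... | yes _  = ∞
  ... | no z≉0 = [ t - z ⁻¹⟨ z≉0 ⟩ ]

  fareyVertex : ∀ {N p x} → Lambda p x → Diagonals N → Fin N → K∞
  fareyVertex {p = p} {x} _ E α =
    compose (λ β → möbius (gonsAt p E β · x)) α ∞

  1/_ : ∀ {p x} → Lambda p x → Carrier
  1/_ {x = x} l = x ⁻¹⟨ Lambda⇒≉0 l ⟩

  scale : Carrier → K∞ → K∞
  scale a ∞     = ∞
  scale a [ z ] = [ a * z ]

{-# OPTIONS --safe #-}
module Submission where

-- Edges of D join vertices of opposite parity: an edge {i, j} that is not a
-- side cuts off a cell, whose p - 1 other sides are shorter edges, and p - 1 is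
-- odd. A triangle of T has no three vertices of pairwise opposite parity, so it
-- contains an odd pair, and an odd pair of a p-gon of D is never one of its
-- sides; hence every triangle lies in exactly one p-gon. A p-gon contains one
-- triangle at each of its even vertices and p/2 triangles at each of its odd
-- vertices. Since p/2 = λ², the Möbius maps of the two paths are conjugate by
-- z ↦ z/λ and z ↦ λz alternately, and these scalings telescope along the path.

open import Defs
open import Algebra.Bundles using (CommutativeRing)
import Algebra.Properties.Ring as RingProperties
import Algebra.Properties.Semiring.Mult as Mult
open import Data.Empty using (⊥)
open import Data.Fin.Base using (Fin; zero; suc; toℕ; fromℕ<; _<_; _≤_)
open import Data.Fin.Patterns using (0F; 1F; 2F)
open import Data.Fin.Properties
  using (all?; any?; _≟_; _<?_; _≤?_; toℕ<n; toℕ-fromℕ<; toℕ-injective; <-cmp; <-trans; <-irrefl; <-asym)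
open import Data.Fin.Subset using (Subset; inside; outside; _∈_; _∉_; _⊆_; ∣_∣)
open import Data.Fin.Subset.Properties using (_∈?_; drop-∷-⊆; ⊆-antisym)
open import Data.List.Base using (List; []; _∷_; map; filter; length; concatMap)
open import Data.List.Membership.Propositional using (find; lose) renaming (_∈_ to _∈ˡ_)
open import Data.List.Membership.Propositional.Properties
  using (∈-map⁺; ∈-map⁻; ∈-++⁺ˡ; ∈-++⁺ʳ; ∈-filter⁺; ∈-filter⁻; ∈-concatMap⁺; ∈-concatMap⁻)
open import Data.List.Membership.Propositional.Properties.WithK using (unique∧set⇒bag)
import Data.List.Properties as List
open import Data.List.Relation.Binary.BagAndSetEquality using (∼bag⇒↭)
open import Data.List.Relation.Binary.Permutation.Propositional.Properties using (↭-length)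
import Data.List.Relation.Unary.All as All
open import Data.List.Relation.Unary.All.Properties using (All¬⇒¬Any)
open import Data.List.Relation.Unary.AllPairs using ([]; _∷_)
open import Data.List.Relation.Unary.Any using (here; there)
open import Data.List.Relation.Unary.Unique.Propositional using (Unique)
import Data.List.Relation.Unary.Unique.Propositional.Properties as Unique
open import Data.Nat.Base as ℕ using (ℕ; z≤n; s≤s; parity)
open import Data.Nat.Divisibility.Core using (divides) renaming (_∣_ to _∣ⁿ_)
import Data.Nat.Properties as ℕ
open import Data.Parity.Base as ℙ using (Parity; 0ℙ; 1ℙ; _⁻¹)
import Data.Parity.Properties as ℙ
open import Data.Product.Base using (_×_; _,_; ∃; proj₁; proj₂)
open import Data.Sum.Base as Sum using (_⊎_; inj₁; inj₂; [_,_]′)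
open import Data.Vec.Base using ([]; _∷_; here; there; head; tail; tabulate)
open import Data.Vec.Properties using (∷-injectiveʳ; lookup∘tabulate; lookup⇒[]=; []=⇒lookup)
open import Function.Base using (_∘_; id)
open import Function.Bundles using (_⇔_; mk⇔; Equivalence)
open import Level using (0ℓ)
import Relation.Binary.Construct.Add.Point.Equality as PointEquality
open import Relation.Binary.Definitions using (Tri; tri<; tri≈; tri>)
open import Relation.Binary.PropositionalEquality
  using (_≡_; _≢_; refl; sym; trans; cong; cong₂; subst; subst₂; module ≡-Reasoning)
import Relation.Binary.Reasoning.Setoid as SetoidReasoning
open import Relation.Nullary.Construct.Add.Point using ([_])
open import Relation.Nullary.Decidable
  using (Dec; yes; no; does; ¬?; _×-dec_; _⊎-dec_; _→-dec_; dec-true; from-yes)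
open import Relation.Nullary.Negation using (¬_; contradiction)
open import Relation.Unary using (Pred; Decidable)

-- Cells are bare vertex sets, so there is no plane in which one polygon lies inside another.
-- Separation replaces geometry: an edge never separates two vertices of one cell, while a point
-- outside a cell is separated, by the side beyond which it lies, from every vertex of the cell
-- except the ends of that side. In a p-gon of D each side has exactly one odd end, so at least one
-- vertex of any odd pair is separated from a given outside point. Both the existence and the
-- uniqueness of the p-gon around a triangle rest on this. The count inside one p-gon is moved along
-- the increasing enumeration of its vertices to an abstract 4-gon or 6-gon, where it is a finite
-- evaluation.

private variable N m : ℕ

-- Enumerating a subset in increasing order

greatest : {P : Pred (Fin m) 0ℓ} → Decidable P → ∃ P → ∃ λ x → P x × ∀ y → P y → y ≤ x
greatest {ℕ.suc m} P? (x , Px) with any? (P? ∘ suc)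
... | yes ∃P = let y , Py , max = greatest (P? ∘ suc) ∃P in
  suc y , Py , λ { zero _ → z≤n ; (suc z) Pz → s≤s (max z Pz) }
greatest P? (zero , P0) | no ∄P = zero , P0 , λ { zero _ → z≤n ; (suc z) Pz → contradiction (z , Pz) ∄P }
greatest P? (suc x , Px) | no ∄P = contradiction (x , Px) ∄P

least : {P : Pred (Fin m) 0ℓ} → Decidable P → ∃ P → ∃ λ x → P x × ∀ y → P y → x ≤ y
least {ℕ.suc m} P? (x , Px) with P? zero
... | yes P0 = zero , P0 , λ _ _ → z≤n
least P? (zero  , Px) | no ¬P0 = contradiction Px ¬P0
least P? (suc x , Px) | no ¬P0 = let y , Py , min = least (P? ∘ suc) (x , Px) in
  suc y , Py , λ { zero P0 → contradiction P0 ¬P0 ; (suc z) Pz → s≤s (min z Pz) }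

nth : (S : Subset N) → Fin ∣ S ∣ → Fin N
nth (outside ∷ S) i       = suc (nth S i)
nth (inside  ∷ S) zero    = zero
nth (inside  ∷ S) (suc i) = suc (nth S i)

nth-∈ : (S : Subset N) (i : Fin ∣ S ∣) → nth S i ∈ S
nth-∈ (outside ∷ S) i       = there (nth-∈ S i)
nth-∈ (inside  ∷ S) zero    = here
nth-∈ (inside  ∷ S) (suc i) = there (nth-∈ S i)

nth-surjective : (S : Subset N) {x : Fin N} → x ∈ S → ∃ λ i → nth S i ≡ x
nth-surjective (inside  ∷ S) here        = zero , refl
nth-surjective (outside ∷ S) (there x∈S) =
  let i , eq = nth-surjective S x∈S in i , cong suc eq
nth-surjective (inside  ∷ S) (there x∈S) =
  let i , eq = nth-surjective S x∈S in suc i , cong suc eq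

nth-mono-< : (S : Subset N) {i j : Fin ∣ S ∣} → i < j → nth S i < nth S j
nth-mono-< (outside ∷ S)                 i<j       = s≤s (nth-mono-< S i<j)
nth-mono-< (inside  ∷ S) {zero}  {suc j} i<j       = s≤s z≤n
nth-mono-< (inside  ∷ S) {suc i} {suc j} (s≤s i<j) = s≤s (nth-mono-< S i<j)

nth-cancel-< : (S : Subset N) {i j : Fin ∣ S ∣} → nth S i < nth S j → i < j
nth-cancel-< S {i} {j} lt with <-cmp i j
... | tri< i<j _ _  = i<j
... | tri≈ _ refl _ = contradiction lt (<-irrefl refl)
... | tri> _ _ j<i  = contradiction (nth-mono-< S j<i) (<-asym lt)

-- The image of `R` under `nth S`, given by recursion on `S` so that cardinality, injectivity and
-- surjectivity onto the subsets of `S` are structural.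
expand : (S : Subset N) → Subset ∣ S ∣ → Subset N
expand []            []      = []
expand (outside ∷ S) R       = outside ∷ expand S R
expand (inside  ∷ S) (r ∷ R) = r ∷ expand S R

∣expand∣ : (S : Subset N) (R : Subset ∣ S ∣) → ∣ expand S R ∣ ≡ ∣ R ∣
∣expand∣ []            []            = refl
∣expand∣ (outside ∷ S) R             = ∣expand∣ S R
∣expand∣ (inside  ∷ S) (outside ∷ R) = ∣expand∣ S R
∣expand∣ (inside  ∷ S) (inside  ∷ R) = cong ℕ.suc (∣expand∣ S R)

expand-injective : (S : Subset N) {R R′ : Subset ∣ S ∣} → expand S R ≡ expand S R′ → R ≡ R′
expand-injective []            {[]}    {[]}    _  = refl
expand-injective (outside ∷ S)                 eq = expand-injective S (cong tail eq)
expand-injective (inside  ∷ S) {r ∷ R} {r′ ∷ R′} eq =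
  cong₂ _∷_ (cong head eq) (expand-injective S (cong tail eq))

expand-⊆ : (S : Subset N) {R : Subset ∣ S ∣} → expand S R ⊆ S
expand-⊆ (outside ∷ S)             (there x∈) = there (expand-⊆ S x∈)
expand-⊆ (inside  ∷ S) {r ∷ R}     here       = here
expand-⊆ (inside  ∷ S) {r ∷ R}     (there x∈) = there (expand-⊆ S x∈)

expand-surjective : (S : Subset N) {Q : Subset N} → Q ⊆ S → ∃ λ R → expand S R ≡ Q
expand-surjective []            {[]}          Q⊆S = [] , refl
expand-surjective (outside ∷ S) {inside ∷ Q}  Q⊆S with () ← Q⊆S here
expand-surjective (outside ∷ S) {outside ∷ Q} Q⊆S =
  let R , eq = expand-surjective S (drop-∷-⊆ Q⊆S) in R , cong (outside ∷_) eq
expand-surjective (inside  ∷ S) {q ∷ Q}       Q⊆S =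
  let R , eq = expand-surjective S (drop-∷-⊆ Q⊆S) in q ∷ R , cong (q ∷_) eq

nth∈expand⁺ : (S : Subset N) {R : Subset ∣ S ∣} {i : Fin ∣ S ∣} → i ∈ R → nth S i ∈ expand S R
nth∈expand⁺ (outside ∷ S)                     i∈R         = there (nth∈expand⁺ S i∈R)
nth∈expand⁺ (inside  ∷ S) {R = _ ∷ _} {zero}  here        = here
nth∈expand⁺ (inside  ∷ S) {R = _ ∷ _} {suc i} (there i∈R) = there (nth∈expand⁺ S i∈R)

nth∈expand⁻ : (S : Subset N) {R : Subset ∣ S ∣} {i : Fin ∣ S ∣} → nth S i ∈ expand S R → i ∈ R
nth∈expand⁻ (outside ∷ S)                     (there i∈) = nth∈expand⁻ S i∈
nth∈expand⁻ (inside  ∷ S) {R = _ ∷ _} {zero}  here       = here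
nth∈expand⁻ (inside  ∷ S) {R = _ ∷ _} {suc i} (there i∈) = there (nth∈expand⁻ S i∈)

between⇒∉ : (S : Subset N) {s t : Fin ∣ S ∣} → ℕ.suc (toℕ s) ≡ toℕ t →
            ∀ k → k ∈ S → ¬ (nth S s < k × k < nth S t)
between⇒∉ S {s} {t} 1+s≡t k k∈S (s<k , k<t) with nth-surjective S k∈S
... | r , refl = ℕ.<-irrefl refl
  (ℕ.<-≤-trans (nth-cancel-< S k<t)
    (subst (ℕ._≤ toℕ r) 1+s≡t (nth-cancel-< S s<k)))

nth-cancel-≤ : (S : Subset N) {i j : Fin ∣ S ∣} → nth S i ≤ nth S j → i ≤ j
nth-cancel-≤ S i≤j = ℕ.≮⇒≥ (λ j<i → ℕ.<⇒≱ (nth-mono-< S j<i) i≤j)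

nth-mono-≤ : (S : Subset N) {i j : Fin ∣ S ∣} → i ≤ j → nth S i ≤ nth S j
nth-mono-≤ S i≤j = ℕ.≮⇒≥ (λ j<i → ℕ.<⇒≱ (nth-cancel-< S j<i) i≤j)

-- The increasing enumeration carries the sides of the abstract polygon on the indices to the
-- cyclically consecutive pairs of `S`; the wrap-around side becomes the pair of least and greatest
-- elements.
side⇒consecutive : (S : Subset N) {s t : Fin ∣ S ∣} → s < t → Side s t → Consecutive S (nth S s) (nth S t)
side⇒consecutive S s<t (inj₁ (inj₁ 1+s≡t)) = inj₁ (between⇒∉ S 1+s≡t)
side⇒consecutive S s<t (inj₁ (inj₂ (_ , t≡0))) with () ← subst (_ ℕ.<_) t≡0 s<t
side⇒consecutive S s<t (inj₂ (inj₁ 1+t≡s)) =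
  contradiction (ℕ.<-trans s<t (ℕ.≤-reflexive 1+t≡s)) (ℕ.<-irrefl refl)
side⇒consecutive S s<t (inj₂ (inj₂ (1+t≡m , s≡0))) = inj₂ bounds
  where
  bounds : ∀ k → k ∈ S → _ ≤ k × k ≤ _
  bounds k k∈S with nth-surjective S k∈S
  ... | r , refl = nth-mono-≤ S (subst (ℕ._≤ _) (sym s≡0) z≤n)
                 , nth-mono-≤ S (ℕ.s≤s⁻¹ (subst (toℕ r ℕ.<_) (sym 1+t≡m) (toℕ<n r)))

consecutive⇒side : (S : Subset N) {s t : Fin ∣ S ∣} → s < t → Consecutive S (nth S s) (nth S t) → Side s t
consecutive⇒side S {s} {t} s<t (inj₁ none) with ℕ.suc (toℕ s) ℕ.≟ toℕ t
... | yes 1+s≡t = inj₁ (inj₁ 1+s≡t)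
... | no  1+s≢t = contradiction
  ( nth-mono-< S (ℕ.≤-reflexive (sym eq))
  , nth-mono-< S (ℕ.≤-<-trans (ℕ.≤-reflexive eq) (ℕ.≤∧≢⇒< s<t 1+s≢t)))
  (none (nth S r) (nth-∈ S r))
  where
  -- The index after `s`; if it is not `t`, its element lies strictly between the two given ones.
  r  = fromℕ< (ℕ.≤-<-trans s<t (toℕ<n t))
  eq = toℕ-fromℕ< (ℕ.≤-<-trans s<t (toℕ<n t))
consecutive⇒side S {s} {t} s<t (inj₂ bounds) = inj₂ (inj₂ (ℕ.≤-antisym (toℕ<n t) (ℕ.≮⇒≥ last) , ℕ.n≤0⇒n≡0 first))
  where
  0<m = ℕ.≤-<-trans z≤n (toℕ<n t)
  first : toℕ s ℕ.≤ 0
  first = subst (toℕ s ℕ.≤_) (toℕ-fromℕ< 0<m)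
    (nth-cancel-≤ S (proj₁ (bounds (nth S (fromℕ< 0<m)) (nth-∈ S _))))
  last : ¬ ℕ.suc (toℕ t) ℕ.< ∣ S ∣
  last lt = ℕ.<-irrefl refl (subst (ℕ._≤ toℕ t) (toℕ-fromℕ< lt)
    (nth-cancel-≤ S (proj₂ (bounds (nth S (fromℕ< lt)) (nth-∈ S _)))))

-- Cells of a non-crossing set of diagonals

comprehension : {P : Pred (Fin N) 0ℓ} → Decidable P → Subset N
comprehension P? = tabulate (does ∘ P?)

∈-comprehension⁺ : {P : Pred (Fin N) 0ℓ} (P? : Decidable P) {x : Fin N} → P x → x ∈ comprehension P?
∈-comprehension⁺ P? {x} Px =
  lookup⇒[]= x _ (trans (lookup∘tabulate (does ∘ P?) x) (dec-true (P? x) Px))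

∈-comprehension⁻ : {P : Pred (Fin N) 0ℓ} (P? : Decidable P) {x : Fin N} → x ∈ comprehension P? → P x
∈-comprehension⁻ P? {x} x∈ with P? x | trans (sym (lookup∘tabulate (does ∘ P?) x)) ([]=⇒lookup x∈)
... | yes Px | _ = Px

-- Separation of vertices by an edge

Inside Outside : Fin N → Fin N → Fin N → Set
Inside  u v x = u < x × x < v
Outside u v x = x < u ⊎ v < x

Separates : Fin N → Fin N → Fin N → Fin N → Set
Separates u v x y = (Inside u v x × Outside u v y) ⊎ (Outside u v x × Inside u v y)

module NonCrossingDiagonals (D : Diagonals N) (nc : NonCrossing D) where
  open Diagonals D

  Edge-sym : {i j : Fin N} → Edge i j → Edge j i
  Edge-sym = Sum.map ∼-sym Sum.swap

  -- `NonCrossing` speaks of diagonals only. A side crosses nothing, because one of the two arcs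
  -- between its ends contains no vertex.
  edges-non-crossing : {i j k l : Fin N} → i < j → j < k → k < l → Edge i k → ¬ Edge j l
  edges-non-crossing i<j j<k k<l (inj₁ i∼k) (inj₁ j∼l) = nc i<j j<k k<l i∼k j∼l
  edges-non-crossing i<j j<k k<l (inj₂ (inj₁ (inj₁ 1+i≡k))) _ =
    ℕ.<⇒≱ j<k (subst (ℕ._≤ _) 1+i≡k i<j)
  edges-non-crossing i<j j<k k<l (inj₂ (inj₁ (inj₂ (_ , k≡0)))) _ =
    ℕ.n≮0 (subst (_ ℕ.<_) k≡0 j<k)
  edges-non-crossing i<j j<k k<l (inj₂ (inj₂ (inj₁ 1+k≡i))) _ =
    ℕ.<-asym (<-trans i<j j<k) (ℕ.≤-reflexive 1+k≡i)
  edges-non-crossing {l = l} i<j j<k k<l (inj₂ (inj₂ (inj₂ (1+k≡N , _)))) _ =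
    ℕ.<⇒≱ (toℕ<n l) (subst (ℕ._≤ toℕ l) 1+k≡N k<l)
  edges-non-crossing i<j j<k k<l _ (inj₂ (inj₁ (inj₁ 1+j≡l))) =
    ℕ.<⇒≱ k<l (subst (ℕ._≤ _) 1+j≡l j<k)
  edges-non-crossing i<j j<k k<l _ (inj₂ (inj₁ (inj₂ (_ , l≡0)))) =
    ℕ.n≮0 (subst (_ ℕ.<_) l≡0 k<l)
  edges-non-crossing i<j j<k k<l _ (inj₂ (inj₂ (inj₁ 1+l≡j))) =
    ℕ.<-asym (<-trans j<k k<l) (ℕ.≤-reflexive 1+l≡j)
  edges-non-crossing i<j j<k k<l _ (inj₂ (inj₂ (inj₂ (_ , j≡0)))) =
    ℕ.n≮0 (subst (_ ℕ.<_) j≡0 i<j)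

  ¬edge-separates-edge : {u v x y : Fin N} → Edge u v → Separates u v x y → ¬ Edge x y
  ¬edge-separates-edge uv (inj₁ ((u<x , x<v) , inj₁ y<u)) xy = edges-non-crossing y<u u<x x<v (Edge-sym xy) uv
  ¬edge-separates-edge uv (inj₁ ((u<x , x<v) , inj₂ v<y)) xy = edges-non-crossing u<x x<v v<y uv xy
  ¬edge-separates-edge uv (inj₂ (inj₁ x<u , (u<y , y<v))) xy = edges-non-crossing x<u u<y y<v xy uv
  ¬edge-separates-edge uv (inj₂ (inj₂ v<x , (u<y , y<v))) xy = edges-non-crossing u<y y<v v<x uv (Edge-sym xy)

  -- The side of the cell S beyond which the point z lies.
  data Gap (S : Subset N) (z : Fin N) : Set where
    inner : ∀ {u v} → u ∈ S → v ∈ S → Edge u v → u < z → z < v →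
            (∀ {x} → x ∈ S → x ≤ u ⊎ v ≤ x) → Gap S z
    outer : ∀ {u v} → u ∈ S → v ∈ S → Edge u v → u < v → Outside u v z →
            (∀ {x} → x ∈ S → u ≤ x × x ≤ v) → Gap S z

  ≤∧≢⇒< : {x y : Fin N} → x ≤ y → x ≢ y → x < y
  ≤∧≢⇒< x≤y x≢y = ℕ.≤∧≢⇒< x≤y (x≢y ∘ toℕ-injective)

  -- The least and greatest elements of `S` are consecutive by the wrap-around alternative, and
  -- everything below or above all of `S` lies beyond that side.
  outer-gap : ∀ {S} → IsCell D S → ∀ {x y z} → x ∈ S → y ∈ S → x < y →
              (∀ {w} → w ∈ S → z < w) ⊎ (∀ {w} → w ∈ S → w < z) → Gap S z
  outer-gap {S} cell {x} {y} x∈S y∈S x<y z-out =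
    let u , u∈S , min = least    (_∈? S) (x , x∈S)
        v , v∈S , max = greatest (_∈? S) (x , x∈S)
        u<v = ℕ.≤-<-trans (min x x∈S) (ℕ.<-≤-trans x<y (max y y∈S))
    in outer u∈S v∈S
         (Equivalence.to (proj₂ cell u v u∈S v∈S u<v) (inj₂ (λ k k∈S → min k k∈S , max k k∈S)))
         u<v (Sum.map (λ z< → z< u∈S) (λ <z → <z v∈S) z-out)
         (λ {w} w∈S → min w w∈S , max w w∈S)

  -- When `S` has elements on both sides of `z`, the nearest ones below and above are consecutive in
  -- `S`, hence joined by an edge; otherwise `outer-gap` applies.
  find-gap : ∀ {S} → IsCell D S → ∀ {x y z} → x ∈ S → y ∈ S → x < y → z ∉ S → Gap S z
  find-gap {S} cell {x} {y} {z} x∈S y∈S x<y z∉S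
    with any? (λ w → (w ∈? S) ×-dec (w <? z)) | any? (λ w → (w ∈? S) ×-dec (z <? w))
  ... | no none | _ = outer-gap cell x∈S y∈S x<y
        (inj₁ (λ w∈S → ≤∧≢⇒< (ℕ.≮⇒≥ (λ w<z → none (_ , w∈S , w<z))) (λ { refl → z∉S w∈S })))
  ... | _ | no none = outer-gap cell x∈S y∈S x<y
        (inj₂ (λ w∈S → ≤∧≢⇒< (ℕ.≮⇒≥ (λ z<w → none (_ , w∈S , z<w))) (λ { refl → z∉S w∈S })))
  ... | yes below | yes above =
    let u , (u∈S , u<z) , max = greatest (λ w → (w ∈? S) ×-dec (w <? z)) below
        v , (v∈S , z<v) , min = least    (λ w → (w ∈? S) ×-dec (z <? w)) above
        u<v = <-trans u<z z<v
        sides : ∀ {w} → w ∈ S → w ≤ u ⊎ v ≤ w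
        sides {w} w∈S = by-position w∈S (<-cmp w z) (λ w<z → max w (w∈S , w<z)) (λ z<w → min w (w∈S , z<w))
    in inner u∈S v∈S
         (Equivalence.to (proj₂ cell u v u∈S v∈S u<v)
           (inj₁ (λ k k∈S (u<k , k<v) → [ ℕ.<⇒≱ u<k , ℕ.<⇒≱ k<v ]′ (sides k∈S))))
         u<z z<v sides
    where
    by-position : ∀ {w u v} → w ∈ S → Tri (w < z) (w ≡ z) (z < w) →
              (w < z → w ≤ u) → (z < w → v ≤ w) → w ≤ u ⊎ v ≤ w
    by-position w∈S (tri< w<z _ _)  l r = inj₁ (l w<z)
    by-position w∈S (tri≈ _ refl _) l r = contradiction w∈S z∉S
    by-position w∈S (tri> _ _ z<w)  l r = inj₂ (r z<w)

  gap-side : ∀ {S z} → Gap S z → ∃ λ u → ∃ λ v → u < v × Edge u v ×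
             (∀ {x} → x ∈ S → x ≢ u → x ≢ v → Separates u v x z)
  gap-side (inner _ _ uv u<z z<v sides) = _ , _ , <-trans u<z z<v , uv , λ x∈S x≢u x≢v →
    inj₂ (Sum.map (λ x≤u → ≤∧≢⇒< x≤u x≢u) (λ v≤x → ≤∧≢⇒< v≤x (x≢v ∘ sym)) (sides x∈S) , u<z , z<v)
  gap-side (outer _ _ uv u<v z-out bounds) = _ , _ , u<v , uv , λ x∈S x≢u x≢v →
    inj₁ ((≤∧≢⇒< (proj₁ (bounds x∈S)) (x≢u ∘ sym) , ≤∧≢⇒< (proj₂ (bounds x∈S)) x≢v) , z-out)

  -- A missing `u` would lie beyond some side `ab` of `S`. Either this contradicts the position of
  -- `x` or `y` relative to `S`, or `uv` crosses `ab`. The right end is treated in the mirror image.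
  left-end∈cell : ∀ {S} → IsCell D S → ∀ {u v x y} → Edge u v →
                  x ∈ S → y ∈ S → Inside u v x → Outside u v y → u ∈ S
  left-end∈cell {S} cell {u} {v} {x} {y} uv x∈S y∈S (u<x , x<v) y-out with u ∈? S
  ... | yes u∈S = u∈S
  ... | no  u∉S = contradiction gapᵤ no-gap
    where
    gapᵤ : Gap S u
    gapᵤ = [ (λ y<u → find-gap cell y∈S x∈S (<-trans y<u u<x) u∉S)
           , (λ v<y → find-gap cell x∈S y∈S (<-trans x<v v<y) u∉S) ]′ y-out
    no-gap : ¬ Gap S u
    no-gap (inner {a} {b} _ _ ab a<u u<b sides) with sides x∈S
    ... | inj₁ x≤a = ℕ.<⇒≱ (<-trans a<u u<x) x≤a
    ... | inj₂ b≤x = edges-non-crossing a<u u<b (ℕ.≤-<-trans b≤x x<v) ab uv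
    no-gap (outer {a} {b} _ _ ab _ (inj₂ b<u) bounds) = ℕ.<⇒≱ (<-trans b<u u<x) (proj₂ (bounds x∈S))
    no-gap (outer {a} {b} _ _ ab _ (inj₁ u<a) bounds) =
      [ (λ y<u → ℕ.<⇒≱ (<-trans y<u u<a) (proj₁ (bounds y∈S)))
      , (λ v<y → edges-non-crossing u<a (ℕ.≤-<-trans (proj₁ (bounds x∈S)) x<v)
                   (ℕ.<-≤-trans v<y (proj₂ (bounds y∈S))) uv ab) ]′ y-out

  right-end∈cell : ∀ {S} → IsCell D S → ∀ {u v x y} → Edge u v →
                   x ∈ S → y ∈ S → Inside u v x → Outside u v y → v ∈ S
  right-end∈cell {S} cell {u} {v} {x} {y} uv x∈S y∈S (u<x , x<v) y-out with v ∈? S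
  ... | yes v∈S = v∈S
  ... | no  v∉S = contradiction gapᵥ no-gap
    where
    gapᵥ : Gap S v
    gapᵥ = [ (λ y<u → find-gap cell y∈S x∈S (<-trans y<u u<x) v∉S)
           , (λ v<y → find-gap cell x∈S y∈S (<-trans x<v v<y) v∉S) ]′ y-out
    no-gap : ¬ Gap S v
    no-gap (inner {a} {b} _ _ ab a<v v<b sides) with sides x∈S
    ... | inj₁ x≤a = edges-non-crossing (ℕ.<-≤-trans u<x x≤a) a<v v<b uv ab
    ... | inj₂ b≤x = ℕ.<⇒≱ (<-trans x<v v<b) b≤x
    no-gap (outer {a} {b} _ _ ab _ (inj₁ v<a) bounds) = ℕ.<⇒≱ (<-trans x<v v<a) (proj₁ (bounds x∈S))
    no-gap (outer {a} {b} _ _ ab _ (inj₂ b<v) bounds) =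
      [ (λ y<u → edges-non-crossing (ℕ.≤-<-trans (proj₁ (bounds y∈S)) y<u)
                   (ℕ.<-≤-trans u<x (proj₂ (bounds x∈S))) b<v ab uv)
      , (λ v<y → ℕ.<⇒≱ (<-trans b<v v<y) (proj₂ (bounds y∈S))) ]′ y-out

  -- A separating edge would have both ends in `S`, hence join consecutive vertices; then no vertex
  -- of `S` is inside it, or none is outside.
  ¬edge-separates-cell : ∀ {S} → IsCell D S → ∀ {u v x y} → Edge u v →
                         x ∈ S → y ∈ S → ¬ Separates u v x y
  ¬edge-separates-cell cell uv x∈S y∈S (inj₂ (x-out , y-in)) =
    ¬edge-separates-cell cell uv y∈S x∈S (inj₁ (y-in , x-out))
  ¬edge-separates-cell cell {u} {v} {x} {y} uv x∈S y∈S (inj₁ (x-in , y-out))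
    with Equivalence.from (proj₂ cell u v (left-end∈cell cell uv x∈S y∈S x-in y-out)
           (right-end∈cell cell uv x∈S y∈S x-in y-out) (<-trans (proj₁ x-in) (proj₂ x-in))) uv
  ... | inj₁ none   = none x x∈S x-in
  ... | inj₂ bounds = [ (λ y<u → ℕ.<⇒≱ y<u (proj₁ (bounds y y∈S)))
                      , (λ v<y → ℕ.<⇒≱ v<y (proj₂ (bounds y y∈S))) ]′ y-out

  three-elements : (S : Subset N) → ∀ {x y z} → x ∈ S → y ∈ S → z ∈ S → x < y → y < z → 3 ℕ.≤ ∣ S ∣
  three-elements S x∈S y∈S z∈S x<y y<z
    with nth-surjective S x∈S | nth-surjective S y∈S | nth-surjective S z∈S
  ... | a , refl | b , refl | c , refl =
    ℕ.≤-trans (s≤s (ℕ.≤-trans (s≤s (ℕ.≤-<-trans z≤n (nth-cancel-< S x<y))) (nth-cancel-< S y<z))) (toℕ<n c)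

  -- The cell on the side of the edge {i, j} that contains the vertices
  -- between i and j: it consists of the vertices not cut off by another edge.
  module CellBelow (i j : Fin N) (1+i<j : ℕ.suc (toℕ i) ℕ.< toℕ j) (ij : Edge i j) where

    i<j : i < j
    i<j = ℕ.<-trans (ℕ.n<1+n _) 1+i<j

    -- The pair `ij` itself is excluded, since otherwise the edge `ij` would hide every vertex
    -- strictly between its ends.
    Under : Fin N → Fin N → Set
    Under a b = i ≤ a × b ≤ j × ¬ (a ≡ i × b ≡ j)

    Covers : Fin N → Fin N → Fin N → Set
    Covers x a b = (a < x × x < b) × Edge a b × Under a b

    Visible : Fin N → Set
    Visible x = (i ≤ x × x ≤ j) × ¬ (∃ λ a → ∃ λ b → Covers x a b)

    Under? : ∀ a b → Dec (Under a b)
    Under? a b = (i ≤? a) ×-dec (b ≤? j) ×-dec ¬? ((a ≟ i) ×-dec (b ≟ j))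

    Visible? : Decidable Visible
    Visible? x = ((i ≤? x) ×-dec (x ≤? j)) ×-dec
      ¬? (any? (λ a → any? (λ b → ((a <? x) ×-dec (x <? b)) ×-dec Edge? a b ×-dec Under? a b)))

    visible : Subset N
    visible = comprehension Visible?

    i-visible : Visible i
    i-visible = (ℕ.≤-refl , ℕ.<⇒≤ i<j) , λ (_ , _ , (a<i , _) , _ , i≤a , _) → ℕ.<⇒≱ a<i i≤a

    j-visible : Visible j
    j-visible = (ℕ.<⇒≤ i<j , ℕ.≤-refl) , λ (_ , _ , (_ , j<b) , _ , _ , b≤j , _) → ℕ.<⇒≱ j<b b≤j

    -- Take the farthest `y` reachable from `x` by an edge under `ij`; `x + 1` is a candidate
    -- because `i + 1 < j`. An edge `ab` covering `y` would cover `x` if `a < x`, contradict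
    -- maximality if `a = x`, and cross `xy` if `x < a`.
    next-visible : ∀ {x} → Visible x → x < j → ∃ λ y → Visible y × x < y × Edge x y × Under x y
    next-visible {x} ((i≤x , x≤j) , uncovered) x<j =
      let y , (x<y , xy , under) , max = greatest Step? (x⁺ , x<x⁺ , inj₂ (inj₁ (inj₁ (sym x⁺≡))) , x⁺-under)
      in y , ((ℕ.≤-trans i≤x (ℕ.<⇒≤ x<y) , proj₁ (proj₂ under)) , unseen x<y xy under max) , x<y , xy , under
      where
      Step : Fin N → Set
      Step y = x < y × Edge x y × Under x y
      Step? : Decidable Step
      Step? y = (x <? y) ×-dec Edge? x y ×-dec Under? x y
      1+x<N = ℕ.≤-<-trans x<j (toℕ<n j)
      x⁺  = fromℕ< 1+x<N
      x⁺≡ : toℕ x⁺ ≡ ℕ.suc (toℕ x)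
      x⁺≡ = toℕ-fromℕ< 1+x<N
      x<x⁺ : x < x⁺
      x<x⁺ = ℕ.≤-reflexive (sym x⁺≡)
      x⁺-under : Under x x⁺
      x⁺-under = i≤x , subst (ℕ._≤ toℕ j) (sym x⁺≡) x<j ,
        λ { (refl , eq) → ℕ.<⇒≢ 1+i<j (trans (sym x⁺≡) (cong toℕ eq)) }
      unseen : ∀ {y} → x < y → Edge x y → Under x y → (∀ z → Step z → z ≤ y) → ¬ (∃ λ a → ∃ λ b → Covers y a b)
      unseen x<y xy _ max (a , b , (a<y , y<b) , ab , under) with <-cmp a x
      ... | tri< a<x _ _  = uncovered (a , b , (a<x , <-trans x<y y<b) , ab , under)
      ... | tri≈ _ refl _ = ℕ.<⇒≱ y<b (max b (<-trans x<y y<b , ab , under))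
      ... | tri> _ _ x<a  = edges-non-crossing x<a a<y y<b xy ab

    -- An edge other than `ij` hides all vertices strictly between its ends; `ij` joins the least
    -- and greatest visible vertices.
    visible-edge⇒consecutive : ∀ {x y} → Visible x → Visible y → Edge x y → Consecutive visible x y
    visible-edge⇒consecutive {x} {y} ((i≤x , _) , _) ((_ , y≤j) , _) xy
      with (x ≟ i) ×-dec (y ≟ j)
    ... | yes (refl , refl) = inj₂ (λ k k∈ → proj₁ (∈-comprehension⁻ Visible? k∈))
    ... | no  xy≢ij         = inj₁ (λ k k∈ x<k<y →
            proj₂ (∈-comprehension⁻ Visible? k∈) (x , y , x<k<y , xy , i≤x , y≤j , xy≢ij))

    -- Let `z` be the visible vertex reached from `x` by `next-visible`. If `z < y`, it contradicts
    -- consecutiveness; if `y < z`, the edge `xz` hides `y`. The wrap-around alternative forces the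
    -- pair to be `ij`.
    consecutive⇒edge : ∀ {x y} → Visible x → Visible y → x < y → Consecutive visible x y → Edge x y
    consecutive⇒edge {x} {y} vx vy x<y (inj₁ none)
      with next-visible vx (ℕ.<-≤-trans x<y (proj₂ (proj₁ vy)))
    ... | z , vz , x<z , xz , under with <-cmp z y
    ... | tri< z<y _ _  = contradiction (x<z , z<y) (none z (∈-comprehension⁺ Visible? vz))
    ... | tri≈ _ refl _ = xz
    ... | tri> _ _ y<z  = contradiction (x , z , (x<y , y<z) , xz , under) (proj₂ vy)
    consecutive⇒edge {x} {y} vx vy x<y (inj₂ bounds) = subst₂ Edge i≡x j≡y ij
      where
      i≡x : i ≡ x
      i≡x = toℕ-injective (ℕ.≤-antisym (proj₁ (proj₁ vx)) (proj₁ (bounds i (∈-comprehension⁺ Visible? i-visible))))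
      j≡y : j ≡ y
      j≡y = toℕ-injective (ℕ.≤-antisym (proj₂ (bounds j (∈-comprehension⁺ Visible? j-visible))) (proj₂ (proj₁ vy)))

    visible-isCell : IsCell D visible
    visible-isCell = three , λ x y x∈ y∈ x<y →
      let vx = ∈-comprehension⁻ Visible? x∈
          vy = ∈-comprehension⁻ Visible? y∈
      in mk⇔ (consecutive⇒edge vx vy x<y) (visible-edge⇒consecutive vx vy)
      where
      three : 3 ℕ.≤ ∣ visible ∣
      three with next-visible i-visible i<j
      -- The third vertex is the one reached from `i`; it differs from `j` because `Under` excludes
      -- `ij`.
      ... | y , vy , i<y , _ , _ , _ , y≢j =
        three-elements visible (∈-comprehension⁺ Visible? i-visible) (∈-comprehension⁺ Visible? vy)
          (∈-comprehension⁺ Visible? j-visible) i<y (≤∧≢⇒< (proj₂ (proj₁ vy)) (λ y≡j → y≢j (refl , y≡j)))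

-- Parity

parity-suc : ∀ n → parity (ℕ.suc n) ≡ parity n ⁻¹
parity-suc ℕ.zero            = refl
parity-suc (ℕ.suc ℕ.zero)    = refl
parity-suc (ℕ.suc (ℕ.suc n)) = parity-suc n

even⇒parity≡0 : ∀ {n} → 2 ∣ⁿ n → parity n ≡ 0ℙ
even⇒parity≡0 (divides ℕ.zero    refl) = refl
even⇒parity≡0 (divides (ℕ.suc q) refl) = even⇒parity≡0 (divides q refl)

parity≡0⇒even : ∀ n → parity n ≡ 0ℙ → 2 ∣ⁿ n
parity≡0⇒even ℕ.zero            _  = divides 0 refl
parity≡0⇒even (ℕ.suc (ℕ.suc n)) eq with parity≡0⇒even n eq
... | divides q refl = divides (ℕ.suc q) refl

Odd⇒parity≡1 : {x : Fin N} → Odd x → parity (toℕ x) ≡ 1ℙ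
Odd⇒parity≡1 {x = x} odd with parity (toℕ x) in eq
... | 0ℙ = contradiction (parity≡0⇒even (toℕ x) eq) odd
... | 1ℙ = refl

parity≡1⇒Odd : {x : Fin N} → parity (toℕ x) ≡ 1ℙ → Odd x
parity≡1⇒Odd eq 2∣x with () ← trans (sym eq) (even⇒parity≡0 2∣x)

odds-same-parity : {x y : Fin N} → Odd x → Odd y → parity (toℕ y) ≢ parity (toℕ x) ⁻¹
odds-same-parity ox oy eq with () ← trans (sym (Odd⇒parity≡1 oy)) (trans eq (cong _⁻¹ (Odd⇒parity≡1 ox)))

alternating : ∀ {m} (f : Fin m → Parity) →
              (∀ s t → ℕ.suc (toℕ s) ≡ toℕ t → f t ≡ f s ⁻¹) →
              ∃ λ c → ∀ t → f t ≡ parity (toℕ t) ℙ.+ c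
alternating {ℕ.zero}  f alt = 0ℙ , λ ()
alternating {ℕ.suc m} f alt = f zero , from-zero f alt
  where
  from-zero : ∀ {m} (f : Fin (ℕ.suc m) → Parity) →
              (∀ s t → ℕ.suc (toℕ s) ≡ toℕ t → f t ≡ f s ⁻¹) →
              ∀ t → f t ≡ parity (toℕ t) ℙ.+ f zero
  from-zero f alt zero = refl
  from-zero {ℕ.suc m} f alt (suc t) = begin
    f (suc t)                               ≡⟨ from-zero (f ∘ suc) (λ s t eq → alt (suc s) (suc t) (cong ℕ.suc eq)) t ⟩
    parity (toℕ t) ℙ.+ f (suc zero)         ≡⟨ cong (parity (toℕ t) ℙ.+_) (alt zero (suc zero) refl) ⟩
    parity (toℕ t) ℙ.+ (f zero ⁻¹)          ≡⟨ shift (parity (toℕ t)) (f zero) ⟩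
    (parity (toℕ t) ⁻¹) ℙ.+ f zero          ≡⟨ cong (ℙ._+ f zero) (parity-suc (toℕ t)) ⟨
    parity (ℕ.suc (toℕ t)) ℙ.+ f zero       ∎
    where
    open ≡-Reasoning
    shift : ∀ a b → a ℙ.+ (b ⁻¹) ≡ (a ⁻¹) ℙ.+ b
    shift 0ℙ b  = refl
    shift 1ℙ 0ℙ = refl
    shift 1ℙ 1ℙ = refl

-- Parities along the edges and cells of an even angulation

module EvenAngulation (D : Diagonals N) (nc : NonCrossing D)
                      {p : ℕ} (p-even : parity p ≡ 0ℙ) (sizes : ∀ S → IsCell D S → ∣ S ∣ ≡ p) where
  open Diagonals D
  open NonCrossingDiagonals D nc public

  vertex-parities : (S : Subset N) →
    (∀ s t → ℕ.suc (toℕ s) ≡ toℕ t → parity (toℕ (nth S t)) ≡ parity (toℕ (nth S s)) ⁻¹) →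
    ∃ λ c → ∀ t → parity (toℕ (nth S t)) ≡ parity (toℕ t) ℙ.+ c
  vertex-parities S = alternating (λ t → parity (toℕ (nth S t)))

  last-parity : ∀ {m t} → parity m ≡ 0ℙ → ℕ.suc t ≡ m → parity t ≡ 1ℙ
  last-parity {t = t} m-even refl with parity t | parity-suc t
  ... | 0ℙ | eq with () ← trans (sym eq) m-even
  ... | 1ℙ | _ = refl

  -- Strong induction on the length of the edge: as p is even, the p − 1 shorter
  -- edges on the other sides of the cell below {i, j} determine the parity.
  edge-parity-bounded : ∀ n {i j} → i < j → toℕ j ℕ.≤ toℕ i ℕ.+ n → Edge i j →
                        parity (toℕ j) ≡ parity (toℕ i) ⁻¹
  edge-parity-bounded ℕ.zero {i} i<j j≤i+n ij = contradiction (subst (_ ℕ.≤_) (ℕ.+-identityʳ _) j≤i+n) (ℕ.<⇒≱ i<j)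
  edge-parity-bounded (ℕ.suc n) {i} {j} i<j j≤i+n ij with ℕ.suc (toℕ i) ℕ.≟ toℕ j
  ... | yes 1+i≡j = trans (cong parity (sym 1+i≡j)) (parity-suc (toℕ i))
  -- The side joining the first and the last vertex of the polygon is treated here like a diagonal.
  ... | no  1+i≢j = ends (nth-surjective S (∈-comprehension⁺ Visible? i-visible))
                         (nth-surjective S (∈-comprehension⁺ Visible? j-visible))
    where
    open CellBelow i j (ℕ.≤∧≢⇒< i<j 1+i≢j) ij hiding (i<j) renaming (visible to S; visible-isCell to S-isCell)
    size = sizes S S-isCell
    bounds : ∀ s → i ≤ nth S s × nth S s ≤ j
    bounds s = proj₁ (∈-comprehension⁻ Visible? (nth-∈ S s))
    step : ∀ s t → ℕ.suc (toℕ s) ≡ toℕ t → parity (toℕ (nth S t)) ≡ parity (toℕ (nth S s)) ⁻¹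
    step s t 1+s≡t = edge-parity-bounded n s<t (shorter (ℕ.m≤n⇒m<n∨m≡n (proj₁ (bounds s))))
      (Equivalence.to (proj₂ S-isCell _ _ (nth-∈ S s) (nth-∈ S t) s<t) (inj₁ (between⇒∉ S 1+s≡t)))
      where
      s<t = nth-mono-< S (ℕ.≤-reflexive 1+s≡t)
      -- A side of `S` starting after `i` loses length on the left; one starting at `i` stops before
      -- `j`, since some visible vertex lies strictly between `i` and `j`.
      shorter : i < nth S s ⊎ toℕ i ≡ toℕ (nth S s) → toℕ (nth S t) ℕ.≤ toℕ (nth S s) ℕ.+ n
      shorter (inj₁ i<s) = begin
        toℕ (nth S t)             ≤⟨ proj₂ (bounds t) ⟩
        toℕ j                     ≤⟨ j≤i+n ⟩
        toℕ i ℕ.+ ℕ.suc n         ≡⟨ ℕ.+-suc (toℕ i) n ⟩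
        ℕ.suc (toℕ i) ℕ.+ n       ≤⟨ ℕ.+-monoˡ-≤ n i<s ⟩
        toℕ (nth S s) ℕ.+ n       ∎
        where open ℕ.≤-Reasoning
      shorter (inj₂ i≡s) = ℕ.s≤s⁻¹ (begin
        ℕ.suc (toℕ (nth S t))           ≤⟨ ≤∧≢⇒< (proj₂ (bounds t)) t≢j ⟩
        toℕ j                           ≤⟨ j≤i+n ⟩
        toℕ i ℕ.+ ℕ.suc n               ≡⟨ ℕ.+-suc (toℕ i) n ⟩
        ℕ.suc (toℕ i ℕ.+ n)             ≡⟨ cong (λ k → ℕ.suc (k ℕ.+ n)) i≡s ⟩
        ℕ.suc (toℕ (nth S s) ℕ.+ n)     ∎)
        where
        open ℕ.≤-Reasoning
        t≢j : nth S t ≢ j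
        t≢j t≡j with next-visible i-visible i<j
        ... | y , vy , i<y , _ , _ , _ , y≢j = between⇒∉ S 1+s≡t y (∈-comprehension⁺ Visible? vy)
          ( subst (ℕ._< toℕ y) i≡s i<y
          , subst (y <_) (sym t≡j) (≤∧≢⇒< (proj₂ (proj₁ vy)) (λ y≡j → y≢j (refl , y≡j))))
    c = proj₁ (vertex-parities S step)
    parities = proj₂ (vertex-parities S step)
    ends : (∃ λ s → nth S s ≡ i) → (∃ λ t → nth S t ≡ j) → parity (toℕ j) ≡ parity (toℕ i) ⁻¹
    ends (s , s≡i) (t , t≡j)
      with consecutive⇒side S (nth-cancel-< S (subst₂ _<_ (sym s≡i) (sym t≡j) i<j))
             (inj₂ (λ k k∈S → let i≤k , k≤j = proj₁ (∈-comprehension⁻ Visible? k∈S) in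
                subst (_≤ k) (sym s≡i) i≤k , subst (k ≤_) (sym t≡j) k≤j))
    ... | inj₁ (inj₁ 1+s≡t) = subst₂ (λ i j → parity (toℕ j) ≡ parity (toℕ i) ⁻¹) s≡i t≡j (step s t 1+s≡t)
    ... | inj₁ (inj₂ (_ , t≡0)) =
      contradiction (subst (toℕ s ℕ.<_) t≡0 (nth-cancel-< S (subst₂ _<_ (sym s≡i) (sym t≡j) i<j))) ℕ.n≮0
    ... | inj₂ (inj₁ 1+t≡s) =
      contradiction (ℕ.≤-reflexive 1+t≡s) (ℕ.<-asym (nth-cancel-< S (subst₂ _<_ (sym s≡i) (sym t≡j) i<j)))
    -- Here `i` has index 0 and `j` the last index, which is odd because `p` is even, so alternation
    -- along `S` flips the parity.
    ... | inj₂ (inj₂ (1+t≡m , s≡0)) = begin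
      parity (toℕ j)                ≡⟨ cong (parity ∘ toℕ) t≡j ⟨
      parity (toℕ (nth S t))        ≡⟨ parities t ⟩
      parity (toℕ t) ℙ.+ c          ≡⟨ cong (ℙ._+ c) (last-parity (trans (cong parity size) p-even) 1+t≡m) ⟩
      c ⁻¹                          ≡⟨ cong (λ k → (parity k ℙ.+ c) ⁻¹) s≡0 ⟨
      (parity (toℕ s) ℙ.+ c) ⁻¹     ≡⟨ cong _⁻¹ (parities s) ⟨
      parity (toℕ (nth S s)) ⁻¹     ≡⟨ cong (λ x → parity (toℕ x) ⁻¹) s≡i ⟩
      parity (toℕ i) ⁻¹             ∎
      where open ≡-Reasoning

  edge-parity : ∀ {i j} → i < j → Edge i j → parity (toℕ j) ≡ parity (toℕ i) ⁻¹
  edge-parity {i} {j} i<j = edge-parity-bounded (toℕ j) i<j (ℕ.m≤n+m (toℕ j) (toℕ i))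

  -- The offset `c` is the parity of the least vertex of `S`, from which the parities alternate.
  cell-parities : ∀ {S} → IsCell D S → ∃ λ c → ∀ t → parity (toℕ (nth S t)) ≡ parity (toℕ t) ℙ.+ c
  cell-parities {S} cell = vertex-parities S λ s t 1+s≡t →
    let s<t = nth-mono-< S (ℕ.≤-reflexive 1+s≡t) in
    edge-parity s<t (Equivalence.to (proj₂ cell _ _ (nth-∈ S s) (nth-∈ S t) s<t) (inj₁ (between⇒∉ S 1+s≡t)))

  -- The ends of the side beyond which `z` lies have opposite parities, so `x` and `y` cannot both
  -- be ends of it, and one that is not is separated from `z`.
  odd-pair-separated : ∀ {S x y z} → IsCell D S → x ≢ y → Odd x → Odd y → x ∈ S → y ∈ S → z ∉ S →
    ∃ λ u → ∃ λ v → Edge u v × (Separates u v x z ⊎ Separates u v y z)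
  odd-pair-separated {S} {x} {y} {z} cell x≢y odd-x odd-y x∈S y∈S z∉S
    with gap-side (a-gap (<-cmp x y))
    where
    a-gap : Tri (x < y) (x ≡ y) (y < x) → Gap S z
    a-gap (tri< x<y _ _) = find-gap cell x∈S y∈S x<y z∉S
    a-gap (tri≈ _ x≡y _) = contradiction x≡y x≢y
    a-gap (tri> _ _ y<x) = find-gap cell y∈S x∈S y<x z∉S
  ... | u , v , u<v , uv , sep with x ≟ u | x ≟ v | y ≟ u | y ≟ v
  ... | no x≢u   | no x≢v   | _        | _        = u , v , uv , inj₁ (sep x∈S x≢u x≢v)
  ... | _        | _        | no y≢u   | no y≢v   = u , v , uv , inj₂ (sep y∈S y≢u y≢v)
  ... | yes refl | _        | yes refl | _        = contradiction refl x≢y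
  ... | _        | yes refl | _        | yes refl = contradiction refl x≢y
  ... | yes refl | _        | _        | yes refl = contradiction (edge-parity u<v uv) (odds-same-parity odd-x odd-y)
  ... | _        | yes refl | yes refl | _        = contradiction (edge-parity u<v uv) (odds-same-parity odd-y odd-x)

  -- A vertex of `S` outside `S′` would be separated by an edge from `x` or `y`, which are vertices
  -- of `S` too.
  cell-through-odd-pair-⊆ : ∀ {S S′ x y} → IsCell D S → IsCell D S′ → x ≢ y → Odd x → Odd y →
    x ∈ S → y ∈ S → x ∈ S′ → y ∈ S′ → S ⊆ S′
  cell-through-odd-pair-⊆ {S} {S′} cell cell′ x≢y ox oy x∈S y∈S x∈S′ y∈S′ {z} z∈S with z ∈? S′
  ... | yes z∈S′ = z∈S′
  ... | no  z∉S′ with odd-pair-separated cell′ x≢y ox oy x∈S′ y∈S′ z∉S′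
  ... | u , v , uv , inj₁ sep = contradiction sep (¬edge-separates-cell cell uv x∈S z∈S)
  ... | u , v , uv , inj₂ sep = contradiction sep (¬edge-separates-cell cell uv y∈S z∈S)

-- Triangles inside a cell

triangle-side : m ≡ 3 → {s t : Fin m} → s < t → Side s t
triangle-side refl {0F} {1F} _ = inj₁ (inj₁ refl)
triangle-side refl {0F} {2F} _ = inj₂ (inj₂ (refl , refl))
triangle-side refl {1F} {2F} _ = inj₁ (inj₁ refl)
triangle-side refl {2F} {1F} (s≤s ())
triangle-side refl {1F} {1F} (s≤s ())
triangle-side refl {2F} {2F} (s≤s (s≤s ()))

-- This reduces being a triangle of T to having three vertices that are pairwise joined.
triangle-consecutive : (Q : Subset N) → ∣ Q ∣ ≡ 3 → ∀ {x y} → x ∈ Q → y ∈ Q → x < y → Consecutive Q x y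
triangle-consecutive Q size x∈Q y∈Q x<y with nth-surjective Q x∈Q | nth-surjective Q y∈Q
... | s , refl | t , refl = side⇒consecutive Q s<t (triangle-side size s<t)
  where s<t = nth-cancel-< Q x<y

triangle-vertices : (Q : Subset N) → ∣ Q ∣ ≡ 3 →
  ∃ λ x → ∃ λ y → ∃ λ z → x ∈ Q × y ∈ Q × z ∈ Q × x < y × y < z
triangle-vertices Q size =
  let a , b , c , a<b , b<c = increasing-triple size in
  nth Q a , nth Q b , nth Q c , nth-∈ Q a , nth-∈ Q b , nth-∈ Q c , nth-mono-< Q a<b , nth-mono-< Q b<c
  where
  increasing-triple : ∀ {m} → m ≡ 3 → ∃ λ (a : Fin m) → ∃ λ (b : Fin m) → ∃ λ (c : Fin m) → a < b × b < c
  increasing-triple refl = 0F , 1F , 2F , ℕ.≤-refl , ℕ.≤-refl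

-- An m-gon of D in which vertex s is labelled by a number of parity s + c:
-- its sides, and the diagonals that the associated triangulation adds to it.
GonEdge : Parity → Fin m → Fin m → Set
GonEdge c s t = (parity (toℕ s) ℙ.+ c ≡ 1ℙ × parity (toℕ t) ℙ.+ c ≡ 1ℙ) ⊎ Side s t

GonEdge? : ∀ c (s t : Fin m) → Dec (GonEdge c s t)
GonEdge? c s t = ((parity (toℕ s) ℙ.+ c ℙ.≟ 1ℙ) ×-dec (parity (toℕ t) ℙ.+ c ℙ.≟ 1ℙ)) ⊎-dec Side? s t

GonTriangle : Parity → Subset m → Set
GonTriangle c R = ∣ R ∣ ≡ 3 × (∀ s t → s ∈ R → t ∈ R → s < t → GonEdge c s t)

GonTriangle? : ∀ c → Decidable (GonTriangle {m} c)
GonTriangle? c R = (∣ R ∣ ℕ.≟ 3) ×-dec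
  all? (λ s → all? (λ t → (s ∈? R) →-dec ((t ∈? R) →-dec ((s <? t) →-dec GonEdge? c s t))))

gonTrianglesAt : ∀ m → Parity → Fin m → ℕ
gonTrianglesAt m c i = length (filter (λ R → GonTriangle? c R ×-dec (i ∈? R)) (subsets m))

-- An even vertex is the tip of one triangle. An odd vertex lies on both triangles of a 4-gon, and
-- on the inner triangle and two outer ones of a 6-gon.
trianglesPerGon : ℕ → Parity → ℕ
trianglesPerGon p 0ℙ = 1
trianglesPerGon p 1ℙ = ℕ.⌊ p /2⌋

-- Decided by evaluation over all subsets of the vertices, for either parity of the first label.
gonTrianglesAt≡ : m ≡ 4 ⊎ m ≡ 6 → ∀ c (i : Fin m) →
                  gonTrianglesAt m c i ≡ trianglesPerGon m (parity (toℕ i) ℙ.+ c)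
gonTrianglesAt≡ (inj₁ refl) 0ℙ = from-yes (all? λ i → gonTrianglesAt 4 0ℙ i ℕ.≟ trianglesPerGon 4 (parity (toℕ i) ℙ.+ 0ℙ))
gonTrianglesAt≡ (inj₁ refl) 1ℙ = from-yes (all? λ i → gonTrianglesAt 4 1ℙ i ℕ.≟ trianglesPerGon 4 (parity (toℕ i) ℙ.+ 1ℙ))
gonTrianglesAt≡ (inj₂ refl) 0ℙ = from-yes (all? λ i → gonTrianglesAt 6 0ℙ i ℕ.≟ trianglesPerGon 6 (parity (toℕ i) ℙ.+ 0ℙ))
gonTrianglesAt≡ (inj₂ refl) 1ℙ = from-yes (all? λ i → gonTrianglesAt 6 1ℙ i ℕ.≟ trianglesPerGon 6 (parity (toℕ i) ℙ.+ 1ℙ))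

-- Triangles of the associated triangulation and the p-gons containing them

module AssociatedTriangulation (D : Diagonals N) (nc : NonCrossing D)
                               {p : ℕ} (p-even : parity p ≡ 0ℙ) (sizes : ∀ S → IsCell D S → ∣ S ∣ ≡ p) where
  open Diagonals D
  open EvenAngulation D nc p-even sizes public

  T : Diagonals N
  T = associated p D

  TEdge : Fin N → Fin N → Set
  TEdge = Diagonals.Edge T

  TEdge-cases : ∀ {x y} → TEdge x y → Edge x y ⊎ OddPair p D x y
  TEdge-cases (inj₁ (inj₁ x∼y)) = inj₁ (inj₁ x∼y)
  TEdge-cases (inj₁ (inj₂ odds)) = inj₂ odds
  TEdge-cases (inj₂ side)       = inj₁ (inj₂ side)

  Edge⇒TEdge : ∀ {x y} → Edge x y → TEdge x y
  Edge⇒TEdge = Sum.map inj₁ id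

  TEdge-sym : ∀ {x y} → TEdge x y → TEdge y x
  TEdge-sym = Sum.map (Diagonals.∼-sym T) Sum.swap

  -- An added diagonal has both ends in one cell of D, and no edge of D separates these.
  ¬edge-separates-TEdge : ∀ {u v x y} → Edge u v → Separates u v x y → ¬ TEdge x y
  ¬edge-separates-TEdge uv sep xy with TEdge-cases xy
  ... | inj₁ edge = ¬edge-separates-edge uv sep edge
  ... | inj₂ (_ , S , (cell , _) , x∈S , y∈S) = ¬edge-separates-cell cell uv x∈S y∈S sep

  triangle-edge : ∀ {Q x y} → IsGonOf 3 T Q → x ∈ Q → y ∈ Q → x ≢ y → TEdge x y
  triangle-edge {Q} {x} {y} ((_ , edges) , size) x∈Q y∈Q x≢y with <-cmp x y
  ... | tri< x<y _ _ = Equivalence.to (edges x y x∈Q y∈Q x<y) (triangle-consecutive Q size x∈Q y∈Q x<y)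
  ... | tri≈ _ x≡y _ = contradiction x≡y x≢y
  ... | tri> _ _ y<x = TEdge-sym (Equivalence.to (edges y x y∈Q x∈Q y<x) (triangle-consecutive Q size y∈Q x∈Q y<x))

  edges⇒triangle : ∀ {Q} → ∣ Q ∣ ≡ 3 → (∀ x y → x ∈ Q → y ∈ Q → x < y → TEdge x y) → IsGonOf 3 T Q
  edges⇒triangle {Q} size edges = (ℕ.≤-reflexive (sym size) , λ x y x∈Q y∈Q x<y →
    mk⇔ (λ _ → edges x y x∈Q y∈Q x<y) (λ _ → triangle-consecutive Q size x∈Q y∈Q x<y)) , size

  -- Edges of D join vertices of opposite parity, so they contain no 3-cycle.
  triangle-odd-pair : ∀ {Q} → IsGonOf 3 T Q → ∃ λ x → ∃ λ y → x ∈ Q × y ∈ Q × OddPair p D x y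
  triangle-odd-pair {Q} tri with triangle-vertices Q (proj₂ tri)
  ... | x , y , z , x∈Q , y∈Q , z∈Q , x<y , y<z
    with TEdge-cases (triangle-edge tri x∈Q y∈Q (ℕ.<⇒≢ x<y ∘ cong toℕ))
       | TEdge-cases (triangle-edge tri y∈Q z∈Q (ℕ.<⇒≢ y<z ∘ cong toℕ))
       | TEdge-cases (triangle-edge tri x∈Q z∈Q (ℕ.<⇒≢ (<-trans x<y y<z) ∘ cong toℕ))
  ... | inj₂ odds | _         | _         = x , y , x∈Q , y∈Q , odds
  ... | _         | inj₂ odds | _         = y , z , y∈Q , z∈Q , odds
  ... | _         | _         | inj₂ odds = x , z , x∈Q , z∈Q , odds
  ... | inj₁ xy   | inj₁ yz   | inj₁ xz
    with parity (toℕ x) | parity (toℕ y) | parity (toℕ z)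
       | edge-parity x<y xy | edge-parity y<z yz | edge-parity (<-trans x<y y<z) xz
  ... | 0ℙ | _ | _ | refl | refl | ()
  ... | 1ℙ | _ | _ | refl | refl | ()

  -- The p-gon is the one witnessing an odd pair of the triangle. If the third vertex were outside
  -- it, an edge of D would separate the ends of a side of the triangle.
  triangle-in-gon : ∀ {Q} → IsGonOf 3 T Q → ∃ λ S → IsGonOf p D S × Q ⊆ S
  triangle-in-gon {Q} tri with triangle-odd-pair tri
  ... | x , y , x∈Q , y∈Q , (x≢y , ox , oy) , S , gon , x∈S , y∈S = S , gon , Q⊆S
    where
    Q⊆S : Q ⊆ S
    Q⊆S {z} z∈Q with z ∈? S
    ... | yes z∈S = z∈S
    ... | no  z∉S with odd-pair-separated (proj₁ gon) x≢y ox oy x∈S y∈S z∉S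
    ... | u , v , uv , inj₁ sep =
      contradiction (triangle-edge tri x∈Q z∈Q λ { refl → z∉S x∈S }) (¬edge-separates-TEdge uv sep)
    ... | u , v , uv , inj₂ sep =
      contradiction (triangle-edge tri y∈Q z∈Q λ { refl → z∉S y∈S }) (¬edge-separates-TEdge uv sep)

  triangle-in-unique-gon : ∀ {Q S S′} → IsGonOf 3 T Q → IsGonOf p D S → IsGonOf p D S′ → Q ⊆ S → Q ⊆ S′ → S ≡ S′
  triangle-in-unique-gon tri gon gon′ Q⊆S Q⊆S′ with triangle-odd-pair tri
  ... | x , y , x∈Q , y∈Q , (x≢y , ox , oy) , _ = ⊆-antisym
    (cell-through-odd-pair-⊆ (proj₁ gon) (proj₁ gon′) x≢y ox oy (Q⊆S x∈Q) (Q⊆S y∈Q) (Q⊆S′ x∈Q) (Q⊆S′ y∈Q))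
    (cell-through-odd-pair-⊆ (proj₁ gon′) (proj₁ gon) x≢y ox oy (Q⊆S′ x∈Q) (Q⊆S′ y∈Q) (Q⊆S x∈Q) (Q⊆S y∈Q))

  module _ {S} (gon : IsGonOf p D S) where

    gon-parity : Parity
    gon-parity = proj₁ (cell-parities (proj₁ gon))

    nth-parity : ∀ t → parity (toℕ (nth S t)) ≡ parity (toℕ t) ℙ.+ gon-parity
    nth-parity = proj₂ (cell-parities (proj₁ gon))

    GonEdge⇒TEdge : ∀ {s t} → s < t → GonEdge gon-parity s t → TEdge (nth S s) (nth S t)
    GonEdge⇒TEdge {s} {t} s<t (inj₁ (os , ot)) = inj₁ (inj₂
      ( ( (λ eq → <-irrefl eq (nth-mono-< S s<t))
        , parity≡1⇒Odd (trans (nth-parity s) os) , parity≡1⇒Odd (trans (nth-parity t) ot))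
      , S , gon , nth-∈ S s , nth-∈ S t))
    GonEdge⇒TEdge {s} {t} s<t (inj₂ side) = Edge⇒TEdge
      (Equivalence.to (proj₂ (proj₁ gon) _ _ (nth-∈ S s) (nth-∈ S t) (nth-mono-< S s<t)) (side⇒consecutive S s<t side))

    TEdge⇒GonEdge : ∀ {s t} → s < t → TEdge (nth S s) (nth S t) → GonEdge gon-parity s t
    TEdge⇒GonEdge {s} {t} s<t st with TEdge-cases st
    ... | inj₁ edge = inj₂ (consecutive⇒side S s<t
      (Equivalence.from (proj₂ (proj₁ gon) _ _ (nth-∈ S s) (nth-∈ S t) (nth-mono-< S s<t)) edge))
    -- Whichever p-gon witnesses the odd pair, the parities of its members place it among the added
    -- diagonals of this one.
    ... | inj₂ ((_ , os , ot) , _) = inj₁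
      (trans (sym (nth-parity s)) (Odd⇒parity≡1 os) , trans (sym (nth-parity t)) (Odd⇒parity≡1 ot))

    triangle⇒gonTriangle : ∀ {R} → IsGonOf 3 T (expand S R) → GonTriangle gon-parity R
    triangle⇒gonTriangle {R} tri = trans (sym (∣expand∣ S R)) (proj₂ tri) , λ s t s∈R t∈R s<t →
      TEdge⇒GonEdge s<t (triangle-edge tri (nth∈expand⁺ S s∈R) (nth∈expand⁺ S t∈R)
        (λ eq → <-irrefl eq (nth-mono-< S s<t)))

    gonTriangle⇒triangle : ∀ {R} → GonTriangle gon-parity R → IsGonOf 3 T (expand S R)
    gonTriangle⇒triangle {R} (size , edges) = edges⇒triangle (trans (∣expand∣ S R) size) TEdges
      where
      TEdges : ∀ x y → x ∈ expand S R → y ∈ expand S R → x < y → TEdge x y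
      TEdges x y x∈ y∈ x<y with nth-surjective S (expand-⊆ S x∈) | nth-surjective S (expand-⊆ S y∈)
      ... | s , refl | t , refl =
        GonEdge⇒TEdge s<t (edges s t (nth∈expand⁻ S x∈) (nth∈expand⁻ S y∈) s<t)
        where s<t = nth-cancel-< S x<y

-- Counting

length-concatMap-const : ∀ {A B : Set} (f : A → List B) {k} (xs : List A) →
                         (∀ {x} → x ∈ˡ xs → length (f x) ≡ k) → length (concatMap f xs) ≡ length xs ℕ.* k
length-concatMap-const f []       _     = refl
length-concatMap-const f (x ∷ xs) const = trans (List.length-++ (f x))
  (cong₂ ℕ._+_ (const (here refl)) (length-concatMap-const f xs (const ∘ there)))

concatMap-unique : ∀ {A B : Set} (f : A → List B) {xs : List A} → Unique xs → (∀ x → Unique (f x)) →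
                   (∀ {x y z} → x ∈ˡ xs → y ∈ˡ xs → z ∈ˡ f x → z ∈ˡ f y → x ≡ y) → Unique (concatMap f xs)
concatMap-unique f []          _   _    = []
concatMap-unique f (x∉ ∷ xs!) f! disj = Unique.++⁺ (f! _)
  (concatMap-unique f xs! f! (λ x∈ y∈ → disj (there x∈) (there y∈)))
  λ (z∈fx , z∈rest) → let y , y∈xs , z∈fy = find (∈-concatMap⁻ f z∈rest) in
    All¬⇒¬Any x∉ (subst (_∈ˡ _) (sym (disj (here refl) (there y∈xs) z∈fx z∈fy)) y∈xs)

unique∧set⇒length : ∀ {A : Set} {xs ys : List A} → Unique xs → Unique ys →
                    (∀ {x} → x ∈ˡ xs ⇔ x ∈ˡ ys) → length xs ≡ length ys
unique∧set⇒length xs! ys! xs⇔ys = ↭-length (∼bag⇒↭ (unique∧set⇒bag xs! ys! xs⇔ys))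

∈-subsets : (S : Subset N) → S ∈ˡ subsets N
∈-subsets []            = here refl
∈-subsets (outside ∷ S) = ∈-++⁺ˡ (∈-map⁺ (outside ∷_) (∈-subsets S))
∈-subsets (inside  ∷ S) = ∈-++⁺ʳ _ (∈-map⁺ (inside ∷_) (∈-subsets S))

subsets-unique : ∀ N → Unique (subsets N)
subsets-unique ℕ.zero    = All.[] ∷ []
subsets-unique (ℕ.suc N) = Unique.++⁺
  (Unique.map⁺ ∷-injectiveʳ (subsets-unique N))
  (Unique.map⁺ ∷-injectiveʳ (subsets-unique N))
  λ (∈out , ∈in) → disjoint (∈-map⁻ _ ∈out) (∈-map⁻ _ ∈in)
  where
  disjoint : ∀ {S : Subset (ℕ.suc N)} → (∃ λ R → R ∈ˡ subsets N × S ≡ outside ∷ R) →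
         (∃ λ R → R ∈ˡ subsets N × S ≡ inside ∷ R) → ⊥
  disjoint (_ , _ , refl) (_ , _ , ())

module Counting (D : Diagonals N) (nc : NonCrossing D) {p : ℕ}
                (p≡4⊎6 : p ≡ 4 ⊎ p ≡ 6) (sizes : ∀ S → IsCell D S → ∣ S ∣ ≡ p) where

  p-even : parity p ≡ 0ℙ
  p-even = [ cong parity , cong parity ]′ p≡4⊎6

  open AssociatedTriangulation D nc p-even sizes

  module _ (α : Fin N) where

    gons : List (Subset N)
    gons = filter (λ S → IsGonOf? p D S ×-dec (α ∈? S)) (subsets N)

    TriangleIn : (S : Subset N) → Subset ∣ S ∣ → Set
    TriangleIn S R = IsGonOf 3 T (expand S R) × α ∈ expand S R

    TriangleIn? : ∀ S → Decidable (TriangleIn S)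
    TriangleIn? S R = IsGonOf? 3 T (expand S R) ×-dec (α ∈? expand S R)

    -- Filtering happens among subsets of the index set, so that the length can be compared with
    -- `gonTrianglesAt`.
    trianglesIn : Subset N → List (Subset N)
    trianglesIn S = map (expand S) (filter (TriangleIn? S) (subsets ∣ S ∣))

    ∈-trianglesIn : ∀ {S Q} → Q ∈ˡ trianglesIn S → IsGonOf 3 T Q × α ∈ Q × Q ⊆ S
    ∈-trianglesIn {S} Q∈ =
      let R , R∈ , Q≡R = ∈-map⁻ (expand S) Q∈
          tri , α∈R = proj₂ (∈-filter⁻ (TriangleIn? S) {xs = subsets ∣ S ∣} R∈)
      in subst (λ Q → IsGonOf 3 T Q × α ∈ Q × Q ⊆ S) (sym Q≡R) (tri , α∈R , expand-⊆ S)

    ∈-gons : ∀ {S} → S ∈ˡ gons → IsGonOf p D S × α ∈ S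
    ∈-gons S∈ = proj₂ (∈-filter⁻ (λ S → IsGonOf? p D S ×-dec (α ∈? S)) {xs = subsets N} S∈)

    length-trianglesIn : ∀ {S} → IsGonOf p D S → (∃ λ i → nth S i ≡ α) →
                         length (trianglesIn S) ≡ trianglesPerGon p (parity (toℕ α))
    length-trianglesIn {S} gon (i , i≡α) = begin
      length (trianglesIn S)
        ≡⟨ List.length-map (expand S) (filter (TriangleIn? S) (subsets ∣ S ∣)) ⟩
      length (filter (TriangleIn? S) (subsets ∣ S ∣))
        ≡⟨ cong length (List.filter-≐ (TriangleIn? S) (λ R → GonTriangle? (gon-parity gon) R ×-dec (i ∈? R))
             (to , from) (subsets ∣ S ∣)) ⟩
      gonTrianglesAt (∣ S ∣) (gon-parity gon) i
        ≡⟨ gonTrianglesAt≡ (subst (λ m → m ≡ 4 ⊎ m ≡ 6) (sym (proj₂ gon)) p≡4⊎6) (gon-parity gon) i ⟩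
      trianglesPerGon (∣ S ∣) (parity (toℕ i) ℙ.+ gon-parity gon)
        ≡⟨ cong₂ trianglesPerGon (proj₂ gon) (sym (nth-parity gon i)) ⟩
      trianglesPerGon p (parity (toℕ (nth S i)))
        ≡⟨ cong (trianglesPerGon p ∘ parity ∘ toℕ) i≡α ⟩
      trianglesPerGon p (parity (toℕ α)) ∎
      where
      open ≡-Reasoning
      to : ∀ {R} → TriangleIn S R → GonTriangle (gon-parity gon) R × i ∈ R
      to {R} (tri , α∈) = triangle⇒gonTriangle gon tri , nth∈expand⁻ S (subst (_∈ expand S R) (sym i≡α) α∈)
      from : ∀ {R} → GonTriangle (gon-parity gon) R × i ∈ R → TriangleIn S R
      from {R} (tri , i∈R) = gonTriangle⇒triangle gon tri , subst (_∈ expand S R) i≡α (nth∈expand⁺ S i∈R)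

    -- The triangles at `α` are the disjoint union, over the p-gons at `α`, of the triangles at `α`
    -- inside them. Both lists are free of repetitions and have the same members, hence equal
    -- length.
    gonsAt-associated : gonsAt 3 T α ≡ gonsAt p D α ℕ.* trianglesPerGon p (parity (toℕ α))
    gonsAt-associated = trans
      (unique∧set⇒length
        (Unique.filter⁺ (λ Q → IsGonOf? 3 T Q ×-dec (α ∈? Q)) (subsets-unique N))
        (concatMap-unique trianglesIn
          (Unique.filter⁺ (λ S → IsGonOf? p D S ×-dec (α ∈? S)) (subsets-unique N))
          (λ S → Unique.map⁺ (expand-injective S) (Unique.filter⁺ (TriangleIn? S) (subsets-unique ∣ S ∣)))
          (λ S∈ S′∈ Q∈ Q∈′ →
            let tri , _ , Q⊆S  = ∈-trianglesIn Q∈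
                _   , _ , Q⊆S′ = ∈-trianglesIn Q∈′
            in triangle-in-unique-gon tri (proj₁ (∈-gons S∈)) (proj₁ (∈-gons S′∈)) Q⊆S Q⊆S′))
        (mk⇔ to from))
      (length-concatMap-const trianglesIn gons constant)
      where
      constant : ∀ {S} → S ∈ˡ gons → length (trianglesIn S) ≡ trianglesPerGon p (parity (toℕ α))
      constant {S} S∈ = length-trianglesIn (proj₁ (∈-gons S∈)) (nth-surjective S (proj₂ (∈-gons S∈)))
      to : ∀ {Q} → Q ∈ˡ filter (λ Q → IsGonOf? 3 T Q ×-dec (α ∈? Q)) (subsets N) → Q ∈ˡ concatMap trianglesIn gons
      to {Q} Q∈ =
        let _ , tri , α∈Q   = ∈-filter⁻ (λ Q → IsGonOf? 3 T Q ×-dec (α ∈? Q)) {xs = subsets N} Q∈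
            S , gon , Q⊆S = triangle-in-gon tri
            R , R≡Q       = expand-surjective S Q⊆S
        in ∈-concatMap⁺ trianglesIn (lose
             (∈-filter⁺ (λ S → IsGonOf? p D S ×-dec (α ∈? S)) (∈-subsets S) (gon , Q⊆S α∈Q))
             (subst (_∈ˡ trianglesIn S) R≡Q (∈-map⁺ (expand S) (∈-filter⁺ (TriangleIn? S) (∈-subsets R)
               (subst (λ Q → IsGonOf 3 T Q × α ∈ Q) (sym R≡Q) (tri , α∈Q))))))
      from : ∀ {Q} → Q ∈ˡ concatMap trianglesIn gons → Q ∈ˡ filter (λ Q → IsGonOf? 3 T Q ×-dec (α ∈? Q)) (subsets N)
      from Q∈ =
        let S , _ , Q∈S = find (∈-concatMap⁻ trianglesIn {xs = gons} Q∈)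
            tri , α∈Q , _ = ∈-trianglesIn {S} Q∈S
        in ∈-filter⁺ (λ Q → IsGonOf? 3 T Q ×-dec (α ∈? Q)) (∈-subsets _) (tri , α∈Q)

-- Farey paths

module FareyScaling {c ℓ₁ ℓ₂} (K : OrderedField c ℓ₁ ℓ₂) where
  open OrderedField K
  open Farey K
  open CommutativeRing commutativeRing
    using (*-cong; *-congˡ; *-congʳ; *-assoc; *-comm; *-identityˡ; *-identityʳ; zeroʳ; distribˡ; +-cong; +-assoc; +-identityʳ; -‿cong; ring)
  open RingProperties ring using (-‿distribʳ-*)
  open Mult semiring using (×-assocˡ; ×-congʳ; ×-comm-*) renaming (_×_ to _·_)
  open SetoidReasoning setoid

  inverseʳ : ∀ x (x≉0 : ¬ (x ≈ 0#)) → x * x ⁻¹⟨ x≉0 ⟩ ≈ 1#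
  inverseʳ x x≉0 = proj₂ (inverse x x≉0)

  inverse-unique : ∀ {x y z} → x * y ≈ 1# → x * z ≈ 1# → y ≈ z
  inverse-unique {x} {y} {z} xy≈1 xz≈1 = begin
    y            ≈⟨ *-identityʳ y ⟨
    y * 1#       ≈⟨ *-congˡ xz≈1 ⟨
    y * (x * z)  ≈⟨ *-assoc y x z ⟨
    (y * x) * z  ≈⟨ *-congʳ (*-comm y x) ⟩
    (x * y) * z  ≈⟨ *-congʳ xy≈1 ⟩
    1# * z       ≈⟨ *-identityˡ z ⟩
    z            ∎

  cancel-scaling : ∀ {a b} → a * b ≈ 1# → ∀ x → a * (b * x) ≈ x
  cancel-scaling {a} {b} ab≈1 x = begin
    a * (b * x)  ≈⟨ *-assoc a b x ⟨
    (a * b) * x  ≈⟨ *-congʳ ab≈1 ⟩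
    1# * x       ≈⟨ *-identityˡ x ⟩
    x            ∎

  -- Since `1/b = a`, one has `a t - 1/(b z) = a (t - 1/z)`: scaling by `b` before the map becomes
  -- scaling by `a` after it. Zero and infinity match because `b` is invertible.
  möbius-scale : ∀ {a b} → a * b ≈ 1# → ∀ {t t′ z z′} → t′ ≈ a * t → z′ ≈∞ scale b z →
                 möbius t′ z′ ≈∞ scale a (möbius t z)
  möbius-scale ab≈1 {z = ∞} t′≈at PointEquality.∙≈∙ = PointEquality.[ t′≈at ]
  möbius-scale {a} {b} ab≈1 {t} {t′} {[ z ]} {[ z′ ]} t′≈at PointEquality.[ z′≈bz ] with z ≈? 0# | z′ ≈? 0#
  ... | yes _   | yes _    = PointEquality.∙≈∙
  ... | yes z≈0 | no z′≉0  = contradiction (≈-trans z′≈bz (≈-trans (*-congˡ z≈0) (zeroʳ b))) z′≉0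
  ... | no z≉0  | yes z′≈0 = contradiction (begin
    z            ≈⟨ cancel-scaling ab≈1 z ⟨
    a * (b * z)  ≈⟨ *-congˡ (≈-trans (≈-sym z′≈bz) z′≈0) ⟩
    a * 0#       ≈⟨ zeroʳ a ⟩
    0#           ∎) z≉0
  ... | no z≉0  | no z′≉0  = PointEquality.[ begin
    t′ - z′ ⁻¹⟨ z′≉0 ⟩             ≈⟨ +-cong t′≈at (-‿cong (inverse-unique (inverseʳ z′ z′≉0) z′az⁻¹≈1)) ⟩
    a * t - a * z ⁻¹⟨ z≉0 ⟩        ≈⟨ +-cong ≈-refl (-‿distribʳ-* a _) ⟩
    a * t + a * (- z ⁻¹⟨ z≉0 ⟩)    ≈⟨ distribˡ a t _ ⟨
    a * (t - z ⁻¹⟨ z≉0 ⟩)          ∎ ]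
    where
    z′az⁻¹≈1 : z′ * (a * z ⁻¹⟨ z≉0 ⟩) ≈ 1#
    z′az⁻¹≈1 = begin
      z′ * (a * z ⁻¹⟨ z≉0 ⟩)       ≈⟨ *-congʳ z′≈bz ⟩
      (b * z) * (a * z ⁻¹⟨ z≉0 ⟩)  ≈⟨ *-assoc (b * z) a _ ⟨
      ((b * z) * a) * z ⁻¹⟨ z≉0 ⟩  ≈⟨ *-congʳ (*-comm (b * z) a) ⟩
      (a * (b * z)) * z ⁻¹⟨ z≉0 ⟩  ≈⟨ *-congʳ (cancel-scaling ab≈1 z) ⟩
      z * z ⁻¹⟨ z≉0 ⟩              ≈⟨ inverseʳ z z≉0 ⟩
      1#                           ∎

  byParity : Carrier → Carrier → Parity → Carrier
  byParity a b 0ℙ = a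
  byParity a b 1ℙ = b

  -- Removing the first map shifts all indices by one and so exchanges the two scalings.
  byParity-suc : ∀ a b n → byParity a b (parity (ℕ.suc n)) ≡ byParity b a (parity n)
  byParity-suc a b n rewrite parity-suc n with parity n
  ... | 0ℙ = refl
  ... | 1ℙ = refl

  -- Conjugation by z ↦ a z and by z ↦ b z = a⁻¹ z alternates along the composition.
  compose-möbius-scale : ∀ {N a b} → a * b ≈ 1# → (t t′ : Fin N → Carrier) →
    (∀ β → t′ β ≈ byParity a b (parity (toℕ β)) * t β) →
    ∀ α → compose (möbius ∘ t′) α ∞ ≈∞ scale a (compose (möbius ∘ t) α ∞)
  compose-möbius-scale         ab≈1 t t′ t′≈ zero    = PointEquality.∙≈∙
  compose-möbius-scale {a = a} {b} ab≈1 t t′ t′≈ (suc α) = möbius-scale ab≈1 (t′≈ zero)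
    (compose-möbius-scale (≈-trans (*-comm b a) ab≈1) (t ∘ suc) (t′ ∘ suc)
      (λ β → subst (λ k → t′ (suc β) ≈ k * t (suc β)) (byParity-suc a b (toℕ β)) (t′≈ (suc β))) α)

  trianglesPerGon-λ : ∀ {p x} → p ≡ 4 ⊎ p ≡ 6 → (isλ : Lambda p x) → ∀ π →
                      trianglesPerGon p π · 1# ≈ byParity (1/ isλ) x π * x
  trianglesPerGon-λ {x = x} _ isλ 0ℙ = begin
    1# + 0#        ≈⟨ +-identityʳ 1# ⟩
    1#             ≈⟨ inverseʳ x (Lambda⇒≉0 isλ) ⟨
    x * (1/ isλ)   ≈⟨ *-comm x (1/ isλ) ⟩
    (1/ isλ) * x   ∎
  trianglesPerGon-λ {x = x} _ (λ₄ _ x²≈2) 1ℙ = begin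
    1# + (1# + 0#)         ≈⟨ +-cong ≈-refl (+-identityʳ 1#) ⟩
    1# + 1#                ≈⟨ x²≈2 ⟨
    x * x                  ∎
  trianglesPerGon-λ {x = x} _ (λ₆ _ x²≈3) 1ℙ = begin
    1# + (1# + (1# + 0#))  ≈⟨ +-cong ≈-refl (+-cong ≈-refl (+-identityʳ 1#)) ⟩
    1# + (1# + 1#)         ≈⟨ +-assoc 1# 1# 1# ⟨
    (1# + 1#) + 1#         ≈⟨ x²≈3 ⟨
    x * x                  ∎
  trianglesPerGon-λ (inj₁ ()) (λ₃ _) 1ℙ
  trianglesPerGon-λ (inj₂ ()) (λ₃ _) 1ℙ

  scaled-multiple : ∀ q {r x a} → r · 1# ≈ a * x → (q ℕ.* r) · 1# ≈ a * (q · x)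
  scaled-multiple q {r} {x} {a} r≈ax = begin
    (q ℕ.* r) · 1#  ≈⟨ ×-assocˡ 1# q r ⟨
    q · (r · 1#)    ≈⟨ ×-congʳ q r≈ax ⟩
    q · (a * x)     ≈⟨ ×-comm-* q a x ⟨
    a * (q · x)     ∎

  -- The outermost map belongs to vertex 0, which is even; hence the factor that survives is `1/λ`
  -- and not `λ`.
  farey-scale : ∀ {N p x} → p ≡ 4 ⊎ p ≡ 6 → (isλ : Lambda p x) → (D E : Diagonals N) →
    (∀ β → gonsAt 3 E β ≡ gonsAt p D β ℕ.* trianglesPerGon p (parity (toℕ β))) →
    ∀ α → fareyVertex 1-isλ₃ E α ≈∞ scale (1/ isλ) (fareyVertex isλ D α)
  farey-scale {p = p} {x} p≡4⊎6 isλ D E counts =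
    compose-möbius-scale (≈-trans (*-comm (1/ isλ) x) (inverseʳ x (Lambda⇒≉0 isλ)))
      (λ β → gonsAt p D β · x) (λ β → gonsAt 3 E β · 1#)
      (λ β → subst (λ q → q · 1# ≈ byParity (1/ isλ) x (parity (toℕ β)) * (gonsAt p D β · x)) (sym (counts β))
        (scaled-multiple (gonsAt p D β) (trianglesPerGon-λ p≡4⊎6 isλ (parity (toℕ β)))))

open import Data.Nat.Base using (_+_)

proposition20 : ∀ {c ℓ₁ ℓ₂} (K : OrderedField c ℓ₁ ℓ₂) →
    let open Farey K in
    (p : ℕ) → p ≡ 4 ⊎ p ≡ 6 →
    (λp : OrderedField.Carrier K) (isλp : Lambda p λp) →
    (n : ℕ) (D : Diagonals (n + 3)) → IsAngulation p D →
    (α : Fin (n + 3)) →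
    fareyVertex 1-isλ₃ (associated p D) α ≈∞ scale (1/ isλp) (fareyVertex isλp D α)
proposition20 K p p≡4⊎6 λp isλp n D (nc , sizes) =
  farey-scale p≡4⊎6 isλp D (associated p D) (Counting.gonsAt-associated D nc p≡4⊎6 sizes)
  where open FareyScaling K
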